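{- Let $r$ be a positive integer and let $\epsilon>0$. Then there exists a constant $\kappa=\kappa(r,\epsilon)>0$, depending only on $r$ and $\epsilon$, such that the following holds. For every integer $n\ge 2$ there exist an integer $k\le\kappa\ln n$ and linear forms $\ell_{ij}:\mathbb{R}^n\to\mathbb{R}$, $i=1,\ldots,k$, $j=1,\ldots,r$, such that the polynomial $\tilde e_r(\mathbf{x})=\sum_{i=1}^k\prod_{j=1}^r\ell_{ij}(\mathbf{x})$ is a linear combination of square-free monomials of degree $r$, $$\tilde e_r(\mathbf{x})=\sum_{\substack{I=\{i_1,\ldots,i_r\}\\ 1\le i_1<i_2<\cdots<i_r\le n}}\tilde e_{r,I}\,x_{i_1}\cdots x_{i_r},$$ and $$(1-\epsilon)^r\le\tilde e_{r,I}\le(1+\epsilon)^r$$ for all $r$-element subsets $I\subset\{1,\ldots,n\}$.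
   Context: $\mathbf{x}=(x_1,\ldots,x_n)$. A linear form is a homogeneous linear function $\mathbb{R}^n\to\mathbb{R}$. -}

module Defs where

open import Algebra.Bundles.Raw using (RawRing)
open import Algebra.Module.Bundles.Raw using (RawLeftModule)
open import Data.Bool.Base using (if_then_else_)
open import Data.Fin.Base using (Fin; toℕ)
open import Data.Fin.Subset using (Subset; inside; outside; ∣_∣)
open import Data.Integer.Base as ℤ using (+_; +[1+_]; +0; -[1+_])
open import Data.List.Base as List using (List; []; _∷_; _++_)
open import Data.Nat.Base as ℕ using (ℕ; zero; suc)
open import Data.Product.Base using (∃-syntax; _×_; _,_; proj₁; proj₂)
open import Data.Rational.Base as ℚ using (ℚ; 0ℚ; 1ℚ; ½)
open import Data.Rational.Solver using (module +-*-Solver)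
open import Data.Rational.Unnormalised.Base as ℚᵘ using (mkℚᵘ; *≤*; *≡*)
open import Data.Sum.Base using (inj₁; inj₂)
open import Data.Vec.Base as Vec using ([]; _∷_)
open import Level using (0ℓ)
open import Relation.Binary.PropositionalEquality
import Algebra.Definitions.RawMonoid as RawMonoidDefinitions
import Algebra.Definitions.RawSemiring as RawSemiringDefinitions
import Algebra.Module.Construct.TensorUnit as TensorUnit
import Algebra.Module.Morphism.Structures as ModuleMorphisms
import Data.Integer.Properties as ℤ
import Data.Nat.Properties as ℕ
import Data.Nat.Solver as ℕSolver
import Data.Rational.Properties as ℚ
import Data.Rational.Unnormalised.Properties as ℚᵘ

-- Real numbers are Cauchy sequences of rationals carrying a modulus of
-- convergence, identified up to ≈; the strict order x < y carries a
-- positive rational gap, so it is the constructively strong one.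

IsCauchy : (ℕ → ℚ) → Set
IsCauchy a = ∀ ε → 0ℚ ℚ.< ε →
  ∃[ N ] (∀ m n → N ℕ.≤ m → N ℕ.≤ n → ℚ.∣ a m ℚ.- a n ∣ ℚ.≤ ε)

record ℝ : Set where
  constructor mkℝ
  field
    seq    : ℕ → ℚ
    cauchy : IsCauchy seq

open ℝ public

infix 4 _≈_ _≤_ _<_

_≈_ : ℝ → ℝ → Set
x ≈ y = ∀ ε → 0ℚ ℚ.< ε →
  ∃[ N ] (∀ n → N ℕ.≤ n → ℚ.∣ seq x n ℚ.- seq y n ∣ ℚ.≤ ε)

_≤_ : ℝ → ℝ → Set
x ≤ y = ∀ ε → 0ℚ ℚ.< ε →
  ∃[ N ] (∀ n → N ℕ.≤ n → seq x n ℚ.≤ seq y n ℚ.+ ε)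

_<_ : ℝ → ℝ → Set
x < y = ∃[ ε ] (0ℚ ℚ.< ε ×
  ∃[ N ] (∀ n → N ℕ.≤ n → seq x n ℚ.+ ε ℚ.≤ seq y n))

fromℚ : ℚ → ℝ
fromℚ q = mkℝ (λ _ → q) λ ε 0<ε → 0 , λ _ _ _ _ →
  subst (ℚ._≤ ε) (sym (cong ℚ.∣_∣ (ℚ.+-inverseʳ q))) (ℚ.<⇒≤ 0<ε)

fromℕ : ℕ → ℝ
fromℕ n = fromℚ (+ n ℚ./ 1)

0ℝ 1ℝ : ℝ
0ℝ = fromℚ 0ℚ
1ℝ = fromℚ 1ℚ

private
  0<½*_ : ∀ {ε} → 0ℚ ℚ.< ε → 0ℚ ℚ.< ½ ℚ.* ε
  0<½*_ {ε} 0<ε = subst (ℚ._< ½ ℚ.* ε) (ℚ.*-zeroʳ ½) (ℚ.*-monoʳ-<-pos ½ 0<ε)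

  ½+½ : ∀ ε → ½ ℚ.* ε ℚ.+ ½ ℚ.* ε ≡ ε
  ½+½ = solve 1 (λ e → con ½ :* e :+ con ½ :* e := e) refl
    where open +-*-Solver

  +-cauchy : ∀ a b → IsCauchy a → IsCauchy b → IsCauchy (λ n → a n ℚ.+ b n)
  +-cauchy a b ca cb ε 0<ε with ca (½ ℚ.* ε) (0<½* 0<ε) | cb (½ ℚ.* ε) (0<½* 0<ε)
  ... | N₁ , p | N₂ , q = N₁ ℕ.⊔ N₂ , λ m n N≤m N≤n → begin
      ℚ.∣ (a m ℚ.+ b m) ℚ.- (a n ℚ.+ b n) ∣
        ≡⟨ cong ℚ.∣_∣ (rearrange (a m) (b m) (a n) (b n)) ⟩
      ℚ.∣ (a m ℚ.- a n) ℚ.+ (b m ℚ.- b n) ∣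
        ≤⟨ ℚ.∣p+q∣≤∣p∣+∣q∣ (a m ℚ.- a n) (b m ℚ.- b n) ⟩
      ℚ.∣ a m ℚ.- a n ∣ ℚ.+ ℚ.∣ b m ℚ.- b n ∣
        ≤⟨ ℚ.+-mono-≤
             (p m n (ℕ.m⊔n≤o⇒m≤o N₁ N₂ N≤m) (ℕ.m⊔n≤o⇒m≤o N₁ N₂ N≤n))
             (q m n (ℕ.m⊔n≤o⇒n≤o N₁ N₂ N≤m) (ℕ.m⊔n≤o⇒n≤o N₁ N₂ N≤n)) ⟩
      ½ ℚ.* ε ℚ.+ ½ ℚ.* ε
        ≡⟨ ½+½ ε ⟩
      ε ∎
    where
    open ℚ.≤-Reasoning
    rearrange : ∀ s t u v → (s ℚ.+ t) ℚ.- (u ℚ.+ v) ≡ (s ℚ.- u) ℚ.+ (t ℚ.- v)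
    rearrange = solve 4 (λ s t u v → (s :+ t) :- (u :+ v) := (s :- u) :+ (t :- v)) refl
      where open +-*-Solver

  neg-cauchy : ∀ a → IsCauchy a → IsCauchy (λ n → ℚ.- a n)
  neg-cauchy a ca ε 0<ε with ca ε 0<ε
  ... | N , p = N , λ m n N≤m N≤n →
      subst (ℚ._≤ ε) (sym (trans (cong ℚ.∣_∣ (sym (ℚ.neg-distrib-+ (a m) (ℚ.- a n))))
                                 (ℚ.∣-p∣≡∣p∣ (a m ℚ.- a n))))
            (p m n N≤m N≤n)

  eventuallyBounded : ∀ a → IsCauchy a →
    ∃[ B ] (ℚ.Positive B × ∃[ N ] (∀ n → N ℕ.≤ n → ℚ.∣ a n ∣ ℚ.≤ B))
  eventuallyBounded a ca with ca 1ℚ (ℚ.positive⁻¹ 1ℚ)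
  ... | N , p = 1ℚ ℚ.+ ℚ.∣ a N ∣ , ℚ.pos+nonNeg⇒pos 1ℚ ℚ.∣ a N ∣ {{ℚ.∣-∣-nonNeg (a N)}} , N ,
      λ n N≤n → begin
        ℚ.∣ a n ∣                               ≡⟨ cong ℚ.∣_∣ (split (a n) (a N)) ⟩
        ℚ.∣ (a n ℚ.- a N) ℚ.+ a N ∣             ≤⟨ ℚ.∣p+q∣≤∣p∣+∣q∣ (a n ℚ.- a N) (a N) ⟩
        ℚ.∣ a n ℚ.- a N ∣ ℚ.+ ℚ.∣ a N ∣         ≤⟨ ℚ.+-monoˡ-≤ ℚ.∣ a N ∣ (p n N N≤n ℕ.≤-refl) ⟩
        1ℚ ℚ.+ ℚ.∣ a N ∣                        ∎
    where
    open ℚ.≤-Reasoning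
    split : ∀ s t → s ≡ (s ℚ.- t) ℚ.+ t
    split = solve 2 (λ s t → s := (s :- t) :+ t) refl
      where open +-*-Solver

  *-bound : ∀ A p q δ → ℚ.Positive A → ℚ.∣ p ∣ ℚ.≤ A → ℚ.∣ q ∣ ℚ.≤ δ → ℚ.∣ p ℚ.* q ∣ ℚ.≤ A ℚ.* δ
  *-bound A p q δ A>0 p≤A q≤δ = begin
      ℚ.∣ p ℚ.* q ∣          ≡⟨ ℚ.∣p*q∣≡∣p∣*∣q∣ p q ⟩
      ℚ.∣ p ∣ ℚ.* ℚ.∣ q ∣    ≤⟨ ℚ.*-monoʳ-≤-nonNeg ℚ.∣ q ∣ {{ℚ.∣-∣-nonNeg q}} p≤A ⟩
      A ℚ.* ℚ.∣ q ∣          ≤⟨ ℚ.*-monoˡ-≤-nonNeg A {{ℚ.pos⇒nonNeg A {{A>0}}}} q≤δ ⟩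
      A ℚ.* δ                ∎
    where open ℚ.≤-Reasoning

  divide : ∀ A → ℚ.Positive A → ∀ ε → 0ℚ ℚ.< ε → ∃[ δ ] (0ℚ ℚ.< δ × A ℚ.* δ ≡ ε)
  divide A A>0 ε 0<ε = A⁻¹ ℚ.* ε
    , subst (ℚ._< A⁻¹ ℚ.* ε) (ℚ.*-zeroʳ A⁻¹) (ℚ.*-monoʳ-<-pos A⁻¹ {{ℚ.1/pos⇒pos A {{A>0}}}} 0<ε)
    , trans (sym (ℚ.*-assoc A A⁻¹ ε))
            (trans (cong (ℚ._* ε) (ℚ.*-inverseʳ A {{ℚ.pos⇒nonZero A {{A>0}}}})) (ℚ.*-identityˡ ε))
    where
    A⁻¹ : ℚ
    A⁻¹ = ℚ.1/_ A {{ℚ.pos⇒nonZero A {{A>0}}}}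

  *-step : ∀ A B δ η ε a b a′ b′ → ℚ.Positive A → ℚ.Positive B →
    A ℚ.* δ ≡ ½ ℚ.* ε → B ℚ.* η ≡ ½ ℚ.* ε →
    ℚ.∣ a ∣ ℚ.≤ A → ℚ.∣ b′ ∣ ℚ.≤ B → ℚ.∣ b ℚ.- b′ ∣ ℚ.≤ δ → ℚ.∣ a ℚ.- a′ ∣ ℚ.≤ η →
    ℚ.∣ a ℚ.* b ℚ.- a′ ℚ.* b′ ∣ ℚ.≤ ε
  *-step A B δ η ε a b a′ b′ A>0 B>0 Aδ Bη a≤A b≤B b≤δ a≤η = begin
      ℚ.∣ a ℚ.* b ℚ.- a′ ℚ.* b′ ∣
        ≡⟨ cong ℚ.∣_∣ (rearrange a b a′ b′) ⟩
      ℚ.∣ a ℚ.* (b ℚ.- b′) ℚ.+ b′ ℚ.* (a ℚ.- a′) ∣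
        ≤⟨ ℚ.∣p+q∣≤∣p∣+∣q∣ (a ℚ.* (b ℚ.- b′)) (b′ ℚ.* (a ℚ.- a′)) ⟩
      ℚ.∣ a ℚ.* (b ℚ.- b′) ∣ ℚ.+ ℚ.∣ b′ ℚ.* (a ℚ.- a′) ∣
        ≤⟨ ℚ.+-mono-≤ (*-bound A a (b ℚ.- b′) δ A>0 a≤A b≤δ)
                      (*-bound B b′ (a ℚ.- a′) η B>0 b≤B a≤η) ⟩
      A ℚ.* δ ℚ.+ B ℚ.* η
        ≡⟨ cong₂ ℚ._+_ Aδ Bη ⟩
      ½ ℚ.* ε ℚ.+ ½ ℚ.* ε
        ≡⟨ ½+½ ε ⟩
      ε ∎
    where
    open ℚ.≤-Reasoning
    rearrange : ∀ s t u v →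
      s ℚ.* t ℚ.- u ℚ.* v ≡ s ℚ.* (t ℚ.- v) ℚ.+ v ℚ.* (s ℚ.- u)
    rearrange = solve 4 (λ s t u v → s :* t :- u :* v := s :* (t :- v) :+ v :* (s :- u)) refl
      where open +-*-Solver

  *-cauchy : ∀ a b → IsCauchy a → IsCauchy b → IsCauchy (λ n → a n ℚ.* b n)
  *-cauchy a b ca cb ε 0<ε =
    let A , A>0 , N₁ , a≤A = eventuallyBounded a ca
        B , B>0 , N₂ , b≤B = eventuallyBounded b cb
        δ , 0<δ , Aδ = divide A A>0 (½ ℚ.* ε) (0<½* 0<ε)
        η , 0<η , Bη = divide B B>0 (½ ℚ.* ε) (0<½* 0<ε)
        N₃ , p = cb δ 0<δ
        N₄ , q = ca η 0<η
        N₁₂ = N₁ ℕ.⊔ N₂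
        N₃₄ = N₃ ℕ.⊔ N₄
    in N₁₂ ℕ.⊔ N₃₄ , λ m n N≤m N≤n →
      let M≤m = ℕ.m⊔n≤o⇒n≤o N₁₂ N₃₄ N≤m
          M≤n = ℕ.m⊔n≤o⇒n≤o N₁₂ N₃₄ N≤n
      in *-step A B δ η ε (a m) (b m) (a n) (b n) A>0 B>0 Aδ Bη
           (a≤A m (ℕ.m⊔n≤o⇒m≤o N₁ N₂ (ℕ.m⊔n≤o⇒m≤o N₁₂ N₃₄ N≤m)))
           (b≤B n (ℕ.m⊔n≤o⇒n≤o N₁ N₂ (ℕ.m⊔n≤o⇒m≤o N₁₂ N₃₄ N≤n)))
           (p m n (ℕ.m⊔n≤o⇒m≤o N₃ N₄ M≤m) (ℕ.m⊔n≤o⇒m≤o N₃ N₄ M≤n))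
           (q m n (ℕ.m⊔n≤o⇒n≤o N₃ N₄ M≤m) (ℕ.m⊔n≤o⇒n≤o N₃ N₄ M≤n))

infix  8 -_
infixl 7 _*_
infixl 6 _+_ _-_

_+_ : ℝ → ℝ → ℝ
x + y = mkℝ (λ n → seq x n ℚ.+ seq y n) (+-cauchy (seq x) (seq y) (cauchy x) (cauchy y))

_*_ : ℝ → ℝ → ℝ
x * y = mkℝ (λ n → seq x n ℚ.* seq y n) (*-cauchy (seq x) (seq y) (cauchy x) (cauchy y))

-_ : ℝ → ℝ
- x = mkℝ (λ n → ℚ.- seq x n) (neg-cauchy (seq x) (cauchy x))

_-_ : ℝ → ℝ → ℝ
x - y = x + (- y)

ℝ-rawRing : RawRing 0ℓ 0ℓ
ℝ-rawRing = record
  { Carrier = ℝ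
  ; _≈_     = _≈_
  ; _+_     = _+_
  ; _*_     = _*_
  ; -_      = -_
  ; 0#      = 0ℝ
  ; 1#      = 1ℝ
  }

open RawSemiringDefinitions (RawRing.rawSemiring ℝ-rawRing) public
  using (sum; product; _^_)

Σ< : ℕ → (ℕ → ℚ) → ℚ
Σ< k f = RawMonoidDefinitions.sum ℚ.+-0-rawMonoid {k} (λ j → f (toℕ j))

-- The left Riemann sum of 1/t on [1 , 1 + p] with mesh 1/M, where
-- M = 1 + m: the j-th of the p M terms is (1/M) · 1/(1 + j/M) = 1/(M + j).
riemann : ℕ → ℕ → ℚ
riemann p m = Σ< (p ℕ.* suc m) (λ j → + 1 ℚ./ (suc m ℕ.+ j))

private
  recip : ℕ → ℚ
  recip j = + 1 ℚ./ suc j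

  recip-pos : ∀ j → 0ℚ ℚ.≤ recip j
  recip-pos j = ℚ.<⇒≤ (ℚ.positive⁻¹ (recip j) {{ℚ.normalize-pos 1 (suc j)}})

  recipᵘ : ∀ j → ℚ.toℚᵘ (recip j) ℚᵘ.≃ mkℚᵘ (+ 1) j
  recipᵘ j = ℚ.toℚᵘ-fromℚᵘ (mkℚᵘ (+ 1) j)

  recip-anti : ∀ {i j} → i ℕ.≤ j → recip j ℚ.≤ recip i
  recip-anti {i} {j} i≤j = ℚ.toℚᵘ-cancel-≤
    (ℚᵘ.≤-respʳ-≃ (ℚᵘ.≃-sym (recipᵘ i)) (ℚᵘ.≤-respˡ-≃ (ℚᵘ.≃-sym (recipᵘ j))
      (*≤* (subst₂ ℤ._≤_ (sym (ℤ.*-identityˡ (+ suc i))) (sym (ℤ.*-identityˡ (+ suc j)))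
        (ℤ.+≤+ (ℕ.s≤s i≤j))))))

  archimedean : ∀ ε → 0ℚ ℚ.< ε → ∃[ N ] (∀ m → N ℕ.≤ m → recip m ℚ.≤ ε)
  archimedean ε@(ℚ.mkℚ +[1+ n ] d _) _ = d , λ m d≤m → ℚ.≤-trans (recip-anti d≤m)
    (ℚ.toℚᵘ-cancel-≤ (ℚᵘ.≤-respˡ-≃ (ℚᵘ.≃-sym (recipᵘ d))
      (*≤* (ℤ.*-monoʳ-≤-nonNeg (+ suc d) {+ 1} {+[1+ n ]} (ℤ.+≤+ (ℕ.s≤s ℕ.z≤n))))))
  archimedean (ℚ.mkℚ +0 _ _) (ℚ.*<* (ℤ.+<+ ()))
  archimedean (ℚ.mkℚ -[1+ _ ] _ _) (ℚ.*<* ())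

  Σ<-cong : ∀ k {f g : ℕ → ℚ} → (∀ j → f j ≡ g j) → Σ< k f ≡ Σ< k g
  Σ<-cong zero    f≡g = refl
  Σ<-cong (suc k) f≡g = cong₂ ℚ._+_ (f≡g 0) (Σ<-cong k (λ j → f≡g (suc j)))

  Σ<-mono : ∀ k {f g : ℕ → ℚ} → (∀ j → j ℕ.< k → f j ℚ.≤ g j) → Σ< k f ℚ.≤ Σ< k g
  Σ<-mono zero    f≤g = ℚ.≤-refl
  Σ<-mono (suc k) f≤g =
    ℚ.+-mono-≤ (f≤g 0 (ℕ.s≤s ℕ.z≤n)) (Σ<-mono k (λ j j<k → f≤g (suc j) (ℕ.s≤s j<k)))

  Σ<-split : ∀ a b (f : ℕ → ℚ) → Σ< (a ℕ.+ b) f ≡ Σ< a f ℚ.+ Σ< b (λ j → f (a ℕ.+ j))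
  Σ<-split zero    b f = sym (ℚ.+-identityˡ (Σ< b f))
  Σ<-split (suc a) b f = trans (cong (f 0 ℚ.+_) (Σ<-split a b (λ j → f (suc j))))
    (sym (ℚ.+-assoc (f 0) (Σ< a (λ j → f (suc j))) (Σ< b (λ j → f (suc a ℕ.+ j)))))

  Σ<-blocks : ∀ a b (f : ℕ → ℚ) →
    Σ< (a ℕ.* b) f ≡ Σ< a (λ i → Σ< b (λ s → f (i ℕ.* b ℕ.+ s)))
  Σ<-blocks zero    b f = refl
  Σ<-blocks (suc a) b f = trans (Σ<-split b (a ℕ.* b) f) (cong (Σ< b f ℚ.+_)
    (trans (Σ<-blocks a b (λ j → f (b ℕ.+ j)))
           (Σ<-cong a (λ i → Σ<-cong b (λ s → cong f (sym (ℕ.+-assoc b (i ℕ.* b) s)))))))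

  Σ<-telescope : ∀ n (f : ℕ → ℚ) → Σ< n f ℚ.+ f n ≡ f 0 ℚ.+ Σ< n (λ j → f (suc j))
  Σ<-telescope zero    f = ℚ.+-comm 0ℚ (f 0)
  Σ<-telescope (suc n) f =
    trans (ℚ.+-assoc (f 0) (Σ< n (λ j → f (suc j))) (f (suc n)))
          (cong (f 0 ℚ.+_) (Σ<-telescope n (λ j → f (suc j))))

  Σ<-const : ∀ k q → Σ< k (λ _ → q) ≡ (+ k ℚ./ 1) ℚ.* q
  Σ<-const zero    q = sym (ℚ.*-zeroˡ q)
  Σ<-const (suc k) q = begin
      q ℚ.+ Σ< k (λ _ → q)                    ≡⟨ cong (q ℚ.+_) (Σ<-const k q) ⟩
      q ℚ.+ (+ k ℚ./ 1) ℚ.* q                 ≡⟨ factor q (+ k ℚ./ 1) ⟩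
      (1ℚ ℚ.+ (+ k ℚ./ 1)) ℚ.* q              ≡⟨ cong (ℚ._* q) 1+k ⟩
      (+ suc k ℚ./ 1) ℚ.* q                   ∎
    where
    open ≡-Reasoning
    factor : ∀ s t → s ℚ.+ t ℚ.* s ≡ (1ℚ ℚ.+ t) ℚ.* s
    factor = solve 2 (λ s t → s :+ t :* s := (con 1ℚ :+ t) :* s) refl
      where open +-*-Solver
    1+k : 1ℚ ℚ.+ (+ k ℚ./ 1) ≡ + suc k ℚ./ 1
    1+k = ℚ.toℚᵘ-injective (ℚᵘ.≃-trans (ℚ.toℚᵘ-homo-+ 1ℚ (+ k ℚ./ 1))
      (ℚᵘ.≃-trans (ℚᵘ.+-congʳ ℚᵘ.1ℚᵘ (ℚ.toℚᵘ-fromℚᵘ (mkℚᵘ (+ k) 0)))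
      (ℚᵘ.≃-trans (*≡* (cong (ℤ._* + 1) (cong (λ z → + 1 ℤ.+ z) (ℤ.*-identityʳ (+ k)))))
                  (ℚᵘ.≃-sym (ℚ.toℚᵘ-fromℚᵘ (mkℚᵘ (+ suc k) 0))))))

  -- (1 + k) copies of 1/((1 + a)(1 + k)) add up to 1/(1 + a).
  recip-blocks : ∀ a k → Σ< (suc k) (λ _ → recip (k ℕ.+ a ℕ.* suc k)) ≡ recip a
  recip-blocks a k = trans (Σ<-const (suc k) q) (ℚ.toℚᵘ-injective
    (ℚᵘ.≃-trans (ℚ.toℚᵘ-homo-* (+ suc k ℚ./ 1) q)
    (ℚᵘ.≃-trans (ℚᵘ.*-cong (ℚ.toℚᵘ-fromℚᵘ (mkℚᵘ (+ suc k) 0)) (recipᵘ (k ℕ.+ a ℕ.* suc k)))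
    (ℚᵘ.≃-trans (*≡* (cong +_ eq)) (ℚᵘ.≃-sym (recipᵘ a))))))
    where
    q : ℚ
    q = recip (k ℕ.+ a ℕ.* suc k)
    eq : (suc k ℕ.* 1) ℕ.* suc a ≡ 1 ℕ.* (1 ℕ.* suc (k ℕ.+ a ℕ.* suc k))
    eq = solve 2 (λ k a → ((con 1 :+ k) :* con 1) :* (con 1 :+ a)
                       := con 1 :* (con 1 :* (con 1 :+ (k :+ a :* (con 1 :+ k))))) refl k a
      where open ℕSolver.+-*-Solver

  riemannʳ : ℕ → ℕ → ℚ
  riemannʳ p m = Σ< (p ℕ.* suc m) (λ j → recip (m ℕ.+ suc j))

  riemannʳ≤riemann : ∀ p m → riemannʳ p m ℚ.≤ riemann p m
  riemannʳ≤riemann p m = Σ<-mono (p ℕ.* suc m) (λ j _ → recip-anti (ℕ.+-monoʳ-≤ m (ℕ.n≤1+n j)))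

  riemann≤riemannʳ : ∀ p m → riemann p m ℚ.≤ recip m ℚ.+ riemannʳ p m
  riemann≤riemannʳ p m = begin
      riemann p m                                   ≡⟨ ℚ.+-identityʳ (riemann p m) ⟨
      riemann p m ℚ.+ 0ℚ                            ≤⟨ ℚ.+-monoʳ-≤ (riemann p m) (recip-pos (m ℕ.+ n)) ⟩
      riemann p m ℚ.+ recip (m ℕ.+ n)               ≡⟨ Σ<-telescope n (λ j → recip (m ℕ.+ j)) ⟩
      recip (m ℕ.+ 0) ℚ.+ riemannʳ p m              ≡⟨ cong (λ z → recip z ℚ.+ riemannʳ p m) (ℕ.+-identityʳ m) ⟩
      recip m ℚ.+ riemannʳ p m                      ∎
    where
    open ℚ.≤-Reasoning
    n : ℕ
    n = p ℕ.* suc m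

  refine : ∀ p m k (f : ℕ → ℚ) →
    Σ< (p ℕ.* suc (k ℕ.+ m ℕ.* suc k)) f
      ≡ Σ< (p ℕ.* suc m) (λ i → Σ< (suc k) (λ s → f (i ℕ.* suc k ℕ.+ s)))
  refine p m k f = trans (cong (λ z → Σ< z f) (sym (ℕ.*-assoc p (suc m) (suc k))))
                         (Σ<-blocks (p ℕ.* suc m) (suc k) f)

  riemann-refine : ∀ p m k → riemann p (k ℕ.+ m ℕ.* suc k) ℚ.≤ riemann p m
  riemann-refine p m k = begin
      riemann p (k ℕ.+ m ℕ.* suc k)
        ≡⟨ refine p m k (λ j → recip ((k ℕ.+ m ℕ.* suc k) ℕ.+ j)) ⟩
      Σ< (p ℕ.* suc m) (λ i → Σ< (suc k) (λ s → recip ((k ℕ.+ m ℕ.* suc k) ℕ.+ (i ℕ.* suc k ℕ.+ s))))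
        ≤⟨ Σ<-mono (p ℕ.* suc m) (λ i _ → Σ<-mono (suc k) (λ s _ → recip-anti (le i s))) ⟩
      Σ< (p ℕ.* suc m) (λ i → Σ< (suc k) (λ _ → recip (k ℕ.+ (m ℕ.+ i) ℕ.* suc k)))
        ≡⟨ Σ<-cong (p ℕ.* suc m) (λ i → recip-blocks (m ℕ.+ i) k) ⟩
      riemann p m ∎
    where
    open ℚ.≤-Reasoning
    eq : ∀ i s → (k ℕ.+ (m ℕ.+ i) ℕ.* suc k) ℕ.+ s ≡ (k ℕ.+ m ℕ.* suc k) ℕ.+ (i ℕ.* suc k ℕ.+ s)
    eq i s = solve 4 (λ k m i s → (k :+ (m :+ i) :* (con 1 :+ k)) :+ s
                       := (k :+ m :* (con 1 :+ k)) :+ (i :* (con 1 :+ k) :+ s)) refl k m i s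
      where open ℕSolver.+-*-Solver
    le : ∀ i s → k ℕ.+ (m ℕ.+ i) ℕ.* suc k ℕ.≤ (k ℕ.+ m ℕ.* suc k) ℕ.+ (i ℕ.* suc k ℕ.+ s)
    le i s = subst (k ℕ.+ (m ℕ.+ i) ℕ.* suc k ℕ.≤_) (eq i s) (ℕ.m≤m+n _ s)

  riemannʳ-refine : ∀ p m k → riemannʳ p m ℚ.≤ riemannʳ p (k ℕ.+ m ℕ.* suc k)
  riemannʳ-refine p m k = begin
      riemannʳ p m
        ≡⟨ Σ<-cong (p ℕ.* suc m) (λ i → sym (recip-blocks (m ℕ.+ suc i) k)) ⟩
      Σ< (p ℕ.* suc m) (λ i → Σ< (suc k) (λ _ → recip (k ℕ.+ (m ℕ.+ suc i) ℕ.* suc k)))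
        ≤⟨ Σ<-mono (p ℕ.* suc m) (λ i _ → Σ<-mono (suc k) (λ s s<K → recip-anti (le i s s<K))) ⟩
      Σ< (p ℕ.* suc m) (λ i → Σ< (suc k) (λ s → recip ((k ℕ.+ m ℕ.* suc k) ℕ.+ suc (i ℕ.* suc k ℕ.+ s))))
        ≡⟨ refine p m k (λ j → recip ((k ℕ.+ m ℕ.* suc k) ℕ.+ suc j)) ⟨
      riemannʳ p (k ℕ.+ m ℕ.* suc k) ∎
    where
    open ℚ.≤-Reasoning
    eq₁ : ∀ i s → (k ℕ.+ (m ℕ.+ i) ℕ.* suc k) ℕ.+ suc s
                ≡ (k ℕ.+ m ℕ.* suc k) ℕ.+ suc (i ℕ.* suc k ℕ.+ s)
    eq₁ i s = solve 4 (λ k m i s → (k :+ (m :+ i) :* (con 1 :+ k)) :+ (con 1 :+ s)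
                       := (k :+ m :* (con 1 :+ k)) :+ (con 1 :+ (i :* (con 1 :+ k) :+ s))) refl k m i s
      where open ℕSolver.+-*-Solver
    eq₂ : ∀ i → (k ℕ.+ (m ℕ.+ i) ℕ.* suc k) ℕ.+ suc k ≡ k ℕ.+ (m ℕ.+ suc i) ℕ.* suc k
    eq₂ i = solve 3 (λ k m i → (k :+ (m :+ i) :* (con 1 :+ k)) :+ (con 1 :+ k)
                       := k :+ (m :+ (con 1 :+ i)) :* (con 1 :+ k)) refl k m i
      where open ℕSolver.+-*-Solver
    le : ∀ i s → s ℕ.< suc k →
      (k ℕ.+ m ℕ.* suc k) ℕ.+ suc (i ℕ.* suc k ℕ.+ s) ℕ.≤ k ℕ.+ (m ℕ.+ suc i) ℕ.* suc k
    le i s s<K = subst₂ ℕ._≤_ (eq₁ i s) (eq₂ i) (ℕ.+-monoʳ-≤ (k ℕ.+ (m ℕ.+ i) ℕ.* suc k) s<K)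

  common-refinement : ∀ m n → n ℕ.+ m ℕ.* suc n ≡ m ℕ.+ n ℕ.* suc m
  common-refinement m n = ℕ.suc-injective (ℕ.*-comm (suc m) (suc n))

  riemann-near : ∀ p m n → riemann p m ℚ.≤ recip m ℚ.+ riemann p n
  riemann-near p m n = begin
      riemann p m                                  ≤⟨ riemann≤riemannʳ p m ⟩
      recip m ℚ.+ riemannʳ p m                     ≤⟨ ℚ.+-monoʳ-≤ (recip m) step ⟩
      recip m ℚ.+ riemann p n                      ∎
    where
    open ℚ.≤-Reasoning
    step : riemannʳ p m ℚ.≤ riemann p n
    step = ℚ.≤-trans (riemannʳ-refine p m n) (ℚ.≤-trans (riemannʳ≤riemann p (n ℕ.+ m ℕ.* suc n))
      (subst (λ z → riemann p z ℚ.≤ riemann p n) (sym (common-refinement m n)) (riemann-refine p n m)))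

  ∣-∣≤ : ∀ u v ε → u ℚ.≤ ε ℚ.+ v → v ℚ.≤ ε ℚ.+ u → ℚ.∣ u ℚ.- v ∣ ℚ.≤ ε
  ∣-∣≤ u v ε u≤ v≤ with ℚ.∣p∣≡p∨∣p∣≡-p (u ℚ.- v)
  ... | inj₁ eq = subst₂ ℚ._≤_ (sym eq) (cancel ε v) (ℚ.+-monoˡ-≤ (ℚ.- v) u≤)
    where
    cancel : ∀ s t → (s ℚ.+ t) ℚ.- t ≡ s
    cancel = solve 2 (λ s t → (s :+ t) :- t := s) refl
      where open +-*-Solver
  ... | inj₂ eq = subst₂ ℚ._≤_ (trans (flip u v) (sym eq)) (cancel ε u) (ℚ.+-monoˡ-≤ (ℚ.- u) v≤)
    where
    cancel : ∀ s t → (s ℚ.+ t) ℚ.- t ≡ s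
    cancel = solve 2 (λ s t → (s :+ t) :- t := s) refl
      where open +-*-Solver
    flip : ∀ s t → t ℚ.- s ≡ ℚ.- (s ℚ.- t)
    flip = solve 2 (λ s t → t :- s := :- (s :- t)) refl
      where open +-*-Solver

  riemann-cauchy : ∀ p → IsCauchy (riemann p)
  riemann-cauchy p ε 0<ε with archimedean ε 0<ε
  ... | N , small = N , λ m n N≤m N≤n → ∣-∣≤ (riemann p m) (riemann p n) ε
      (ℚ.≤-trans (riemann-near p m n) (ℚ.+-monoˡ-≤ (riemann p n) (small m N≤m)))
      (ℚ.≤-trans (riemann-near p n m) (ℚ.+-monoˡ-≤ (riemann p m) (small n N≤n)))

-- ln n = ∫₁ⁿ dt/t as the limit of its Riemann sums.  Meaningful for
-- n ≥ 1 only; ln 0 is the junk value 0.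
ln : ℕ → ℝ
ln n = mkℝ (riemann (n ℕ.∸ 1)) (riemann-cauchy (n ℕ.∸ 1))

infix 9 ℝ^_

ℝ^_ : ℕ → RawLeftModule ℝ 0ℓ 0ℓ
ℝ^ n = record
  { Carrierᴹ = Fin n → ℝ
  ; _≈ᴹ_     = λ x y → ∀ i → x i ≈ y i
  ; _+ᴹ_     = λ x y i → x i + y i
  ; _*ₗ_     = λ a x i → a * x i
  ; 0ᴹ       = λ _ → 0ℝ
  ; -ᴹ_      = λ x i → - x i
  }

record LinearForm (n : ℕ) : Set where
  open ModuleMorphisms.LeftModuleMorphisms (ℝ^ n) (TensorUnit.rawLeftModule {R = ℝ-rawRing})
  field
    ⟦_⟧      : (Fin n → ℝ) → ℝ
    isLinear : IsLeftModuleHomomorphism ⟦_⟧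

open LinearForm public using (⟦_⟧)

allSubsets : ∀ n → List (Subset n)
allSubsets zero    = [] ∷ []
allSubsets (suc n) = List.map (outside ∷_) (allSubsets n) ++ List.map (inside ∷_) (allSubsets n)

subsetsOfSize : ∀ n → ℕ → List (Subset n)
subsetsOfSize n r = List.filter (λ I → ∣ I ∣ ℕ.≟ r) (allSubsets n)

monomial : ∀ {n} → Subset n → (Fin n → ℝ) → ℝ
monomial I x = product (λ i → if Vec.lookup I i then x i else 1ℝ)

-- The value at x of the combination, with coefficients c, of the
-- square-free monomials of degree r; only the c I with ∣ I ∣ ≡ r matter.
squareFree : ∀ {n} (r : ℕ) → (Subset n → ℝ) → (Fin n → ℝ) → ℝ
squareFree {n} r c x =
  List.foldr _+_ 0ℝ (List.map (λ I → c I * monomial I x) (subsetsOfSize n r))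

{-# OPTIONS --safe #-}
module Submission where

-- A colouring χ of the n variables by r colours gives the product over the colours of the sums
-- of the variables of each colour; expanded, it is the sum of the monomials of those r-sets I
-- that χ maps bijectively onto the colours (the rainbow ones).  A uniformly random χ makes I
-- rainbow with probability r!/rʳ, so among k = O(ln n) random colourings the number of those
-- making I rainbow lies, for all I at once, in an interval [(1 − η)C , C], by an exponential
-- moment bound.  The probabilistic existence is replaced by a greedy choice of the colourings
-- that never increases the moments.  Scaling by (1 + ε)ʳ/C puts every coefficient into
-- [(1 − η)(1 + ε)ʳ , (1 + ε)ʳ], and the lower end is at least (1 − ε)ʳ for small η, also when
-- ε ≥ 1, because |1 − ε| ≤ (1 − η)(1 + ε).

open import Algebra.Bundles using (CommutativeRing; CommutativeSemiring)
open import Data.Bool.Base using (Bool; true; false; not; _∧_; if_then_else_)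
open import Data.Empty using (⊥-elim)
open import Data.Fin.Base using (Fin; zero; suc)
open import Data.Fin.Subset using (Subset; inside; outside; ∣_∣; ⊤)
open import Data.Fin.Subset.Properties using (∣⊤∣≡n)
open import Data.List.Base as List using (List; []; _∷_; _++_; allFin; tabulate; length; cartesianProduct; cartesianProductWith)
open import Data.List.Membership.Propositional using (_∈_)
open import Data.List.Membership.Propositional.Properties using (∈-map⁺; ∈-++⁺ˡ; ∈-++⁺ʳ; ∈-filter⁺; ∈-filter⁻; ∈-cartesianProduct⁺; ∈-cartesianProduct⁻)
open import Data.List.Properties using (length-++; length-map)
open import Data.List.Relation.Unary.Any using (here; there)
open import Data.Nat.Base as ℕ using (ℕ; zero; suc; NonZero)
open import Data.Nat.Tactic.RingSolver using (solve-∀)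
open import Data.Product.Base using (Σ-syntax; ∃-syntax; _×_; _,_; proj₁; proj₂)
open import Data.Rational.Base as ℚ using (ℚ; 0ℚ; 1ℚ; ½; mkℚ)
open import Data.Rational.Solver using (module +-*-Solver)
open import Data.Rational.Unnormalised.Base as ℚᵘ using (mkℚᵘ; *≤*; *≡*)
open import Data.Sum.Base using (inj₁; inj₂)
open import Data.Vec.Base using (Vec; []; _∷_; lookup; _[_]≔_)
open import Function.Base using (_∘_)
open import Level using (0ℓ)
open import Relation.Binary.PropositionalEquality using (_≡_; _≢_; refl; sym; trans; cong; cong₂; subst; subst₂; module ≡-Reasoning)
open import Relation.Nullary using (¬_; Dec; does; yes; no)
import Algebra.Definitions.RawSemiring as RawSemiringDefinitions
import Algebra.Properties.CommutativeSemigroup as CommutativeSemigroupProperties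
import Algebra.Properties.Ring as RingProperties
import Algebra.Properties.Semiring.Sum as SemiringSum
import Data.Fin.Properties as Fin
import Data.Integer.Properties as ℤ
import Data.Nat.Properties as ℕ
import Data.Rational.Properties as ℚ
import Data.Rational.Unnormalised.Properties as ℚᵘ
import Relation.Binary.Reasoning.Setoid as SetoidReasoning
open import Defs using (allSubsets; subsetsOfSize)

-- The exponential moments are products of factors `D` and `D + 1`, so the probabilistic part lives
-- entirely in the natural numbers. The `k = D²tb` colourings amount to `D²t` blocks of `b`, and an
-- event of probability `a/b` is expected `a` times per block. Exceeding `a + 1` times per block on
-- average would cost a factor `1 + 1/D²` per block, hence at least `2ᵗ` in all, which is impossible
-- once there are fewer than `2ᵗ` events. There are at most `2(n + 1)ʳ` of them, so `t = O(ln n)`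
-- suffices; the 2 arises because a lower tail is treated as the upper tail of the complementary
-- event. On the real side, `ε < 1` cannot be decided. Instead `η = 1/(h + 1)` is extracted from the
-- rational gap witnessing `0 < ε` and an upper bound for `ε`, and one inequality covers all cases.

-- Moment bounds for the number of successes, in integer arithmetic.

module Tail where
  open import Data.Nat.Base
  open import Data.Nat.Properties
  open RawSemiringDefinitions +-*-rawSemiring using (sum; product)
  open ≤-Reasoning

  -- Bernoulli's inequality for `(1 + 1/D)ˢ`, multiplied by `Dˢ⁺¹`.
  bernoulli : ∀ D s → D ^ s * (D + s) ≤ suc D ^ s * D
  bernoulli D zero    = ≤-reflexive (cong (1 *_) (+-identityʳ D))
  bernoulli D (suc s) = begin
    D * D ^ s * (D + suc s)              ≤⟨ m≤m+n _ (D ^ s * s) ⟩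
    D * D ^ s * (D + suc s) + D ^ s * s  ≡⟨ lemma D s (D ^ s) ⟩
    suc D * (D ^ s * (D + s))            ≤⟨ *-monoʳ-≤ (suc D) (bernoulli D s) ⟩
    suc D * (suc D ^ s * D)              ≡⟨ *-assoc (suc D) (suc D ^ s) D ⟨
    suc D * suc D ^ s * D                ∎
    where
    lemma : ∀ D s P → D * P * (D + suc s) + P * s ≡ suc D * (P * (D + s))
    lemma = solve-∀

  -- (1 + a/X)ᵐ ≤ 1/(1 − ma/X), cleared of denominators with Y = X − ma.
  bernoulli⁻¹ : ∀ a m X Y → X ≡ Y + m * a → (X + a) ^ m * Y ≤ X ^ m * X
  bernoulli⁻¹ a zero    X Y eq = *-monoʳ-≤ 1 (subst (Y ≤_) (sym eq) (m≤m+n Y 0))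
  bernoulli⁻¹ a (suc m) X Y eq = begin
    (X + a) * (X + a) ^ m * Y       ≡⟨ lemma₁ X Y a ((X + a) ^ m) ⟩
    (X + a) ^ m * (X * Y + a * Y)   ≤⟨ *-monoʳ-≤ ((X + a) ^ m) (+-monoʳ-≤ (X * Y) (*-monoʳ-≤ a Y≤X)) ⟩
    (X + a) ^ m * (X * Y + a * X)   ≡⟨ lemma₂ X Y a ((X + a) ^ m) ⟩
    X * ((X + a) ^ m * (Y + a))     ≤⟨ *-monoʳ-≤ X (bernoulli⁻¹ a m X (Y + a) (trans eq (sym (+-assoc Y a (m * a))))) ⟩
    X * (X ^ m * X)                 ≡⟨ *-assoc X (X ^ m) X ⟨
    X * X ^ m * X                   ∎
    where
    Y≤X : Y ≤ X
    Y≤X = subst (Y ≤_) (sym eq) (m≤m+n Y _)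
    lemma₁ : ∀ X Y a P → (X + a) * P * Y ≡ P * (X * Y + a * Y)
    lemma₁ = solve-∀
    lemma₂ : ∀ X Y a P → P * (X * Y + a * X) ≡ X * (P * (Y + a))
    lemma₂ = solve-∀

  -- (1 + a/bD)ᵇ (1 + 1/D²) ≤ (1 + 1/D)ᵃ⁺¹ for D ≥ a² + a + 1.
  growth : ∀ a b .{{_ : NonZero b}} D → a * a + a + 1 ≤ D →
    suc (D * D) * (D ^ suc a * (b * D + a) ^ b) ≤ D * D * ((b * D) ^ b * suc D ^ suc a)
  growth a b D large with m≤n⇒∃[o]m+o≡n large
  ... | x , refl = begin
    suc (D * D) * (D ^ s * W)        ≤⟨ *-monoˡ-≤ (D ^ s * W) gap ⟩
    E * (D + s) * (D ^ s * W)        ≡⟨ lemma₁ E (D + s) (D ^ s) W ⟩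
    (W * E) * (D ^ s * (D + s))      ≤⟨ *-mono-≤ upper (bernoulli D s) ⟩
    ((b * D) ^ b * D) * (suc D ^ s * D) ≡⟨ lemma₂ ((b * D) ^ b) D (suc D ^ s) ⟩
    D * D * ((b * D) ^ b * suc D ^ s) ∎
    where
    s E W : ℕ
    s = suc a
    E = a * a + 1 + x
    W = (b * D + a) ^ b
    lemma₁ : ∀ E F P W → E * F * (P * W) ≡ (W * E) * (P * F)
    lemma₁ = solve-∀
    lemma₂ : ∀ B D S → (B * D) * (S * D) ≡ D * D * (B * S)
    lemma₂ = solve-∀
    D≡ : ∀ a x → a * a + a + 1 + x ≡ (a * a + 1 + x) + a
    D≡ = solve-∀
    gap≡ : ∀ a x → let D = a * a + a + 1 + x in
      suc (D * D) + x ≡ (a * a + 1 + x) * (D + suc a)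
    gap≡ = solve-∀
    -- Here `E = D − a`, and `(D − a)(D + a + 1) = D² + D − a(a + 1)`; the lower bound on `D` is
    -- what makes this at least `D² + 1`.
    gap : suc (D * D) ≤ E * (D + s)
    gap = subst (suc (D * D) ≤_) (gap≡ a x) (m≤m+n _ x)
    -- `(1 + a/bD)ᵇ ≤ D/E`, from `bernoulli⁻¹` with `X = bD` and `Y = bE`.
    upper : W * E ≤ (b * D) ^ b * D
    upper = *-cancelˡ-≤ b (subst₂ _≤_ (lemma₃ b W E) (lemma₃ b ((b * D) ^ b) D)
      (bernoulli⁻¹ a b (b * D) (b * E) (trans (cong (b *_) (D≡ a x)) (*-distribˡ-+ b E a))))
      where
      lemma₃ : ∀ b P E → P * (b * E) ≡ b * (P * E)
      lemma₃ = solve-∀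

  count : ∀ {k} → (Fin k → Bool) → ℕ
  count R = sum (λ i → if R i then 1 else 0)

  -- D (1 + δ)ᵇ for δ = 1/D and b ∈ {0 , 1}: exponential moments without fractions.
  weight : ℕ → Bool → ℕ
  weight D b = if b then suc D else D

  -- Each true entry turns a factor `D` into `D + 1`; the power of `D` on the left stands in for an
  -- exponent `k − count R`.
  product-weight : ∀ D k (R : Fin k → Bool) →
    D ^ count R * product (weight D ∘ R) ≡ suc D ^ count R * D ^ k
  product-weight D zero    R = refl
  product-weight D (suc k) R with R zero | product-weight D k (R ∘ suc)
  ... | true  | ih = trans (lemma₁ D (D ^ count (R ∘ suc)) (product (weight D ∘ R ∘ suc)))
      (trans (cong (D * suc D *_) ih) (lemma₂ D (suc D ^ count (R ∘ suc)) (D ^ k)))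
    where
    lemma₁ : ∀ D P Q → (D * P) * (suc D * Q) ≡ D * suc D * (P * Q)
    lemma₁ = solve-∀
    lemma₂ : ∀ D P Q → D * suc D * (P * Q) ≡ suc D * P * (D * Q)
    lemma₂ = solve-∀
  ... | false | ih = trans (lemma D (D ^ count (R ∘ suc)) (product (weight D ∘ R ∘ suc)))
      (trans (cong (D *_) ih) (sym (lemma D (suc D ^ count (R ∘ suc)) (D ^ k))))
    where
    lemma : ∀ D P Q → P * (D * Q) ≡ D * (P * Q)
    lemma = solve-∀

  -- The Markov step: a large count forces a large moment, because trading a factor `D` for `D + 1`
  -- only increases the product.
  product-weight-≥ : ∀ D .{{_ : NonZero D}} k (R : Fin k → Bool) m → m ≤ count R →
    suc D ^ m * D ^ k ≤ D ^ m * product (weight D ∘ R)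
  product-weight-≥ D k R m m≤c with m≤n⇒∃[o]m+o≡n m≤c
  ... | o , m+o≡c = *-cancelˡ-≤ (D ^ o) {{m^n≢0 D o}} (begin
    D ^ o * (suc D ^ m * D ^ k)              ≤⟨ *-monoˡ-≤ (suc D ^ m * D ^ k) (^-monoˡ-≤ o (n≤1+n D)) ⟩
    suc D ^ o * (suc D ^ m * D ^ k)          ≡⟨ lemma (suc D ^ o) (suc D ^ m) (D ^ k) ⟩
    (suc D ^ m * suc D ^ o) * D ^ k          ≡⟨ cong (_* D ^ k) (split (suc D)) ⟨
    suc D ^ count R * D ^ k                  ≡⟨ product-weight D k R ⟨
    D ^ count R * product (weight D ∘ R)     ≡⟨ cong (_* product (weight D ∘ R)) (split D) ⟩
    (D ^ m * D ^ o) * product (weight D ∘ R) ≡⟨ lemma (D ^ o) (D ^ m) (product (weight D ∘ R)) ⟨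
    D ^ o * (D ^ m * product (weight D ∘ R)) ∎)
    where
    split : ∀ y → y ^ count R ≡ y ^ m * y ^ o
    split y = trans (cong (y ^_) (sym m+o≡c)) (^-distribˡ-+-* y m o)
    lemma : ∀ P Q S → P * (Q * S) ≡ (Q * P) * S
    lemma = solve-∀

  ^-distribʳ-* : ∀ m n o → (m * n) ^ o ≡ m ^ o * n ^ o
  ^-distribʳ-* m n zero    = refl
  ^-distribʳ-* m n (suc o) = trans (cong (m * n *_) (^-distribʳ-* m n o)) (lemma m n (m ^ o) (n ^ o))
    where
    lemma : ∀ m n P Q → m * n * (P * Q) ≡ m * P * (n * Q)
    lemma = solve-∀

  2*m^m≤[1+m]^m : ∀ m .{{_ : NonZero m}} → 2 * m ^ m ≤ suc m ^ m
  2*m^m≤[1+m]^m m = *-cancelʳ-≤ _ _ m (subst (_≤ suc m ^ m * m) (lemma m (m ^ m)) (bernoulli m m))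
    where
    lemma : ∀ m P → P * (m + m) ≡ 2 * P * m
    lemma = solve-∀

  2^t*m^mt≤[1+m]^mt : ∀ m .{{_ : NonZero m}} t → 2 ^ t * m ^ (m * t) ≤ suc m ^ (m * t)
  2^t*m^mt≤[1+m]^mt m t = subst₂ _≤_
    (trans (^-distribʳ-* 2 (m ^ m) t) (cong (2 ^ t *_) (^-*-assoc m m t))) (^-*-assoc (suc m) m t)
    (^-monoˡ-≤ t (2*m^m≤[1+m]^m m))

  -- The expected count is `k′a`, so the allowed excess is one per block. A larger count gives
  -- `(1 + 1/D)` to the power `k′(a + 1)` at most `J(1 + a/bD)ᵏ`; by `growth` this forces
  -- `(1 + 1/D²)` to the power `D²t` to be at most `J`, although it is at least `2ᵗ`.
  upper-tail : ∀ a b .{{_ : NonZero b}} D → a * a + a + 1 ≤ D → ∀ J t → J < 2 ^ t →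
    let k′ = D * D * t; k = k′ * b in (R : Fin k → Bool) →
    b ^ k * product (weight D ∘ R) ≤ J * (b * D + a) ^ k → count R ≤ k′ * suc a
  upper-tail a b D large J t J<2^t R bound with count R ≤? D * D * t * suc a
  ... | yes c≤ = c≤
  ... | no  c≰ = ⊥-elim (<⇒≱ J<2^t 2^t≤J)
    where
    instance
      D≢0 : NonZero D
      D≢0 = >-nonZero (≤-trans (m≤n+m 1 (a * a + a)) large)
      DD≢0 : NonZero (D * D)
      DD≢0 = m*n≢0 D D
    s k′ k P V W G : ℕ
    s = suc a
    k′ = D * D * t
    k = k′ * b
    P = (b * D) ^ b * suc D ^ s
    W = D ^ s * (b * D + a) ^ b
    V = (b * D + a) ^ k
    G = D * D
    instance
      W≢0 : NonZero (W ^ k′)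
      W≢0 = m^n≢0 W k′ {{m*n≢0 (D ^ s) _ {{m^n≢0 D s}} {{m^n≢0 (b * D + a) b {{>-nonZero
              (≤-trans (>-nonZero⁻¹ (b * D) {{m*n≢0 b D}}) (m≤m+n (b * D) a))}}}}}}
      G^≢0 : NonZero (G ^ k′)
      G^≢0 = m^n≢0 G k′
    pow : ∀ x y e → (x ^ b * y ^ s) ^ e ≡ x ^ (e * b) * y ^ (e * s)
    pow x y e = trans (^-distribʳ-* (x ^ b) (y ^ s) e) (cong₂ _*_
      (trans (^-*-assoc x b e) (cong (x ^_) (*-comm b e)))
      (trans (^-*-assoc y s e) (cong (y ^_) (*-comm s e))))
    P≤JW : P ^ k′ ≤ J * W ^ k′
    P≤JW = begin
      P ^ k′                                     ≡⟨ pow (b * D) (suc D) k′ ⟩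
      (b * D) ^ k * suc D ^ (k′ * s)             ≡⟨ cong (_* suc D ^ (k′ * s)) (^-distribʳ-* b D k) ⟩
      (b ^ k * D ^ k) * suc D ^ (k′ * s)         ≡⟨ lemma₁ (b ^ k) (D ^ k) (suc D ^ (k′ * s)) ⟩
      b ^ k * (suc D ^ (k′ * s) * D ^ k)         ≤⟨ *-monoʳ-≤ (b ^ k) (product-weight-≥ D k R (k′ * s) (<⇒≤ (≰⇒> c≰))) ⟩
      b ^ k * (D ^ (k′ * s) * product (weight D ∘ R)) ≡⟨ lemma₂ (b ^ k) (D ^ (k′ * s)) (product (weight D ∘ R)) ⟩
      D ^ (k′ * s) * (b ^ k * product (weight D ∘ R)) ≤⟨ *-monoʳ-≤ (D ^ (k′ * s)) bound ⟩
      D ^ (k′ * s) * (J * V)                     ≡⟨ lemma₃ (D ^ (k′ * s)) J V ⟩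
      J * (V * D ^ (k′ * s))                     ≡⟨ cong (J *_) (pow (b * D + a) D k′) ⟨
      J * ((b * D + a) ^ b * D ^ s) ^ k′         ≡⟨ cong (λ z → J * z ^ k′) (*-comm ((b * D + a) ^ b) (D ^ s)) ⟩
      J * W ^ k′                                 ∎
      where
      lemma₁ : ∀ x y z → (x * y) * z ≡ x * (z * y)
      lemma₁ = solve-∀
      lemma₂ : ∀ x y z → x * (y * z) ≡ y * (x * z)
      lemma₂ = solve-∀
      lemma₃ : ∀ x y z → x * (y * z) ≡ y * (z * x)
      lemma₃ = solve-∀
    2^t≤J : 2 ^ t ≤ J
    2^t≤J = *-cancelʳ-≤ (2 ^ t) J (G ^ k′) (*-cancelʳ-≤ _ _ (W ^ k′) (begin
      2 ^ t * G ^ k′ * W ^ k′   ≤⟨ *-monoˡ-≤ (W ^ k′) (2^t*m^mt≤[1+m]^mt G t) ⟩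
      suc G ^ k′ * W ^ k′       ≡⟨ ^-distribʳ-* (suc G) W k′ ⟨
      (suc G * W) ^ k′          ≤⟨ ^-monoˡ-≤ k′ (growth a b D large) ⟩
      (G * P) ^ k′              ≡⟨ ^-distribʳ-* G P k′ ⟩
      G ^ k′ * P ^ k′           ≤⟨ *-monoʳ-≤ (G ^ k′) P≤JW ⟩
      G ^ k′ * (J * W ^ k′)     ≡⟨ lemma (G ^ k′) J (W ^ k′) ⟩
      J * G ^ k′ * W ^ k′       ∎))
      where
      lemma : ∀ x y z → x * (y * z) ≡ y * x * z
      lemma = solve-∀

-- Finite sums over lists in a commutative semiring, later used over both ℕ and ℚ.

module ListSum {c ℓ} (S : CommutativeSemiring c ℓ) where
  open CommutativeSemiring S hiding (zero) renaming (refl to ≈-refl; sym to ≈-sym; trans to ≈-trans)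
  open CommutativeSemigroupProperties +-commutativeSemigroup using (interchange)
  open SemiringSum semiring using (sum)

  ∑ : ∀ {A : Set} → List A → (A → Carrier) → Carrier
  ∑ xs f = List.foldr _+_ 0# (List.map f xs)

  module _ {A : Set} where
    ∑-cong : ∀ (xs : List A) {f g} → (∀ x → f x ≈ g x) → ∑ xs f ≈ ∑ xs g
    ∑-cong []       f≈g = ≈-refl
    ∑-cong (x ∷ xs) f≈g = +-cong (f≈g x) (∑-cong xs f≈g)

    ∑-++ : ∀ (xs ys : List A) f → ∑ (xs ++ ys) f ≈ ∑ xs f + ∑ ys f
    ∑-++ []       ys f = ≈-sym (+-identityˡ _)
    ∑-++ (x ∷ xs) ys f = ≈-trans (+-congˡ (∑-++ xs ys f)) (≈-sym (+-assoc _ _ _))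

    ∑-zero : ∀ (xs : List A) → ∑ xs (λ _ → 0#) ≈ 0#
    ∑-zero []       = ≈-refl
    ∑-zero (x ∷ xs) = ≈-trans (+-identityˡ _) (∑-zero xs)

    ∑-distrib-+ : ∀ (xs : List A) f g → ∑ xs (λ x → f x + g x) ≈ ∑ xs f + ∑ xs g
    ∑-distrib-+ []       f g = ≈-sym (+-identityˡ _)
    ∑-distrib-+ (x ∷ xs) f g = ≈-trans (+-congˡ (∑-distrib-+ xs f g)) (interchange _ _ _ _)

    *-distribˡ-∑ : ∀ y (xs : List A) f → y * ∑ xs f ≈ ∑ xs (λ x → y * f x)
    *-distribˡ-∑ y []       f = zeroʳ y
    *-distribˡ-∑ y (x ∷ xs) f = ≈-trans (distribˡ y _ _) (+-congˡ (*-distribˡ-∑ y xs f))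

    ∑-map : ∀ {B : Set} (h : B → A) (xs : List B) f → ∑ (List.map h xs) f ≈ ∑ xs (f ∘ h)
    ∑-map h []       f = ≈-refl
    ∑-map h (x ∷ xs) f = +-congˡ (∑-map h xs f)

    ∑-tabulate : ∀ {n} (h : Fin n → A) f → ∑ (tabulate h) f ≈ sum (f ∘ h)
    ∑-tabulate {zero}  h f = ≈-refl
    ∑-tabulate {suc n} h f = +-congˡ (∑-tabulate (h ∘ suc) f)

  ∑-comm : ∀ {A B : Set} (xs : List A) (ys : List B) (f : A → B → Carrier) →
    ∑ xs (λ x → ∑ ys (f x)) ≈ ∑ ys (λ y → ∑ xs (λ x → f x y))
  ∑-comm []       ys f = ≈-sym (∑-zero ys)
  ∑-comm (x ∷ xs) ys f = ≈-trans (+-congˡ (∑-comm xs ys f))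
    (≈-sym (∑-distrib-+ ys (f x) (λ y → ∑ xs (λ x → f x y))))

  ∑-cartesianProductWith : ∀ {A B C : Set} (h : A → B → C) (xs : List A) (ys : List B) f →
    ∑ (cartesianProductWith h xs ys) f ≈ ∑ xs (λ x → ∑ ys (λ y → f (h x y)))
  ∑-cartesianProductWith h []       ys f = ≈-refl
  ∑-cartesianProductWith h (x ∷ xs) ys f = ≈-trans (∑-++ (List.map (h x) ys) _ f)
    (+-cong (∑-map (h x) ys f) (∑-cartesianProductWith h xs ys f))

-- The method of conditional expectations: choosing the entries of a
-- sequence one at a time, each no worse than average for the current
-- weights, keeps the weighted sum of the products below its mean.
module Derandomisation where
  open import Data.Nat.Base
  open import Data.Nat.Properties
  open ListSum +-*-commutativeSemiring public
  open RawSemiringDefinitions +-*-rawSemiring using (product)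
  open ≤-Reasoning

  ∑-const : ∀ {A : Set} (xs : List A) c → ∑ xs (λ _ → c) ≡ length xs * c
  ∑-const []       c = refl
  ∑-const (x ∷ xs) c = cong (c +_) (∑-const xs c)

  ∑-mono : ∀ {A : Set} (xs : List A) {f g} → (∀ x → x ∈ xs → f x ≤ g x) → ∑ xs f ≤ ∑ xs g
  ∑-mono []       f≤g = ≤-refl
  ∑-mono (x ∷ xs) f≤g = +-mono-≤ (f≤g x (here refl)) (∑-mono xs (λ y → f≤g y ∘ there))

  term≤∑ : ∀ {A : Set} {xs : List A} {x} f → x ∈ xs → f x ≤ ∑ xs f
  term≤∑ f (here refl) = m≤m+n _ _
  term≤∑ f (there x∈)  = m≤n⇒m≤o+n _ (term≤∑ f x∈)

  below-average : ∀ {A : Set} (xs : List A) f c → ∑ xs f < length xs * suc c → ∃[ x ] f x ≤ c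
  below-average (x ∷ xs) f c lt with f x ≤? c
  ... | yes fx≤c = x , fx≤c
  ... | no  fx≰c = below-average xs f c
    (+-cancelˡ-< (suc c) _ _ (≤-<-trans (+-monoˡ-≤ (∑ xs f) (≰⇒> fx≰c)) lt))

  module _ {A B : Set} (xs : List A) {{_ : NonZero (length xs)}} (js : List B)
    (f : B → A → ℕ) (M : ℕ) (mean : ∀ j → j ∈ js → ∑ xs (f j) ≤ length xs * M) where

    greedy-step : (w : B → ℕ) → ∃[ x ] ∑ js (λ j → w j * f j x) ≤ M * ∑ js w
    greedy-step w = below-average xs _ _ (begin-strict
      ∑ xs (λ x → ∑ js (λ j → w j * f j x)) ≡⟨ ∑-comm xs js (λ x j → w j * f j x) ⟩
      ∑ js (λ j → ∑ xs (λ x → w j * f j x)) ≡⟨ ∑-cong js (λ j → *-distribˡ-∑ (w j) xs (f j)) ⟨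
      ∑ js (λ j → w j * ∑ xs (f j))         ≤⟨ ∑-mono js (λ j j∈ → *-monoʳ-≤ (w j) (mean j j∈)) ⟩
      ∑ js (λ j → w j * (length xs * M))    ≡⟨ ∑-cong js (λ j → *-comm (w j) _) ⟩
      ∑ js (λ j → length xs * M * w j)      ≡⟨ *-distribˡ-∑ (length xs * M) js w ⟨
      length xs * M * ∑ js w                ≡⟨ *-assoc (length xs) M _ ⟩
      length xs * (M * ∑ js w)              <⟨ *-monoʳ-< (length xs) (n<1+n _) ⟩
      length xs * suc (M * ∑ js w)          ∎)

    -- The weights are arbitrary because they absorb the factors contributed by the entries already
    -- chosen.
    greedy-weighted : ∀ k (w : B → ℕ) →
      Σ[ χ ∈ (Fin k → A) ] ∑ js (λ j → w j * product {k} (λ i → f j (χ i))) ≤ M ^ k * ∑ js w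
    greedy-weighted zero    w = (λ ()) , (begin
      ∑ js (λ j → w j * 1) ≡⟨ ∑-cong js (λ j → *-identityʳ (w j)) ⟩
      ∑ js w               ≡⟨ *-identityˡ _ ⟨
      1 * ∑ js w           ∎)
    greedy-weighted (suc k) w with greedy-step w
    ... | x , step with greedy-weighted k (λ j → w j * f j x)
    ... | χ , steps = (λ { zero → x ; (suc i) → χ i }) , (begin
      ∑ js (λ j → w j * (f j x * product {k} (λ i → f j (χ i)))) ≡⟨ ∑-cong js (λ j → *-assoc (w j) (f j x) _) ⟨
      ∑ js (λ j → w j * f j x * product {k} (λ i → f j (χ i)))   ≤⟨ steps ⟩
      M ^ k * ∑ js (λ j → w j * f j x)                       ≤⟨ *-monoʳ-≤ (M ^ k) step ⟩
      M ^ k * (M * ∑ js w)                                   ≡⟨ lemma (M ^ k) M (∑ js w) ⟩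
      M ^ suc k * ∑ js w                                     ∎)
      where
      lemma : ∀ x y z → x * (y * z) ≡ y * x * z
      lemma = solve-∀

    -- The union bound: with unit weights, each single moment is at most the sum of all of them.
    greedy : ∀ k → Σ[ χ ∈ (Fin k → A) ] (∀ j → j ∈ js → product {k} (λ i → f j (χ i)) ≤ length js * M ^ k)
    greedy k with greedy-weighted k (λ _ → 1)
    ... | χ , bound = χ , λ j j∈ → begin
      product {k} (λ i → f j (χ i))                  ≡⟨ *-identityˡ _ ⟨
      1 * product {k} (λ i → f j (χ i))              ≤⟨ term≤∑ (λ j → 1 * product {k} (λ i → f j (χ i))) j∈ ⟩
      ∑ js (λ j → 1 * product {k} (λ i → f j (χ i))) ≤⟨ bound ⟩
      M ^ k * ∑ js (λ _ → 1)                     ≡⟨ cong (M ^ k *_) (trans (∑-const js 1) (*-identityʳ _)) ⟩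
      M ^ k * length js                          ≡⟨ *-comm (M ^ k) _ ⟩
      length js * M ^ k                          ∎

-- Counting rainbow colourings.

module Rainbow where
  open import Data.Nat.Base
  open import Data.Nat.Properties
  open Derandomisation
  open Tail
  open SemiringSum +-*-semiring using (sum; sum-cong-≗; *-distribʳ-sum)
  open RawSemiringDefinitions +-*-rawSemiring using (product)

  indicator : Bool → ℕ
  indicator b = if b then 1 else 0

  -- χ maps I bijectively onto the set A of colours.
  rainbow : ∀ {r n} → Subset r → Subset n → Vec (Fin r) n → Bool
  rainbow A []            []      = ∣ A ∣ ≡ᵇ 0
  rainbow A (outside ∷ I) (c ∷ χ) = rainbow A I χ
  rainbow A (inside ∷ I)  (c ∷ χ) = lookup A c ∧ rainbow (A [ c ]≔ outside) I χ

  ∣[]≔outside∣ : ∀ {r} (A : Subset r) c → lookup A c ≡ inside → ∣ A ∣ ≡ suc ∣ A [ c ]≔ outside ∣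
  ∣[]≔outside∣ (inside ∷ A)  zero    eq = refl
  ∣[]≔outside∣ (inside ∷ A)  (suc c) eq = cong suc (∣[]≔outside∣ A c eq)
  ∣[]≔outside∣ (outside ∷ A) (suc c) eq = ∣[]≔outside∣ A c eq

  rainbow-size : ∀ {r n} (A : Subset r) (I : Subset n) χ → ∣ A ∣ ≢ ∣ I ∣ → rainbow A I χ ≡ false
  rainbow-size A []            []      ≢ with ∣ A ∣
  ... | zero  = ⊥-elim (≢ refl)
  ... | suc _ = refl
  rainbow-size A (outside ∷ I) (c ∷ χ) ≢ = rainbow-size A I χ ≢
  rainbow-size A (inside ∷ I)  (c ∷ χ) ≢ with lookup A c in eq
  ... | false = refl
  ... | true  = rainbow-size (A [ c ]≔ outside) I χ
    (λ eq′ → ≢ (trans (∣[]≔outside∣ A c eq) (cong suc eq′)))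

  colourings : ∀ r n → List (Vec (Fin r) n)
  colourings r zero    = [] ∷ []
  colourings r (suc n) = cartesianProductWith _∷_ (allFin r) (colourings r n)

  ∑-colourings : ∀ r n f → ∑ (colourings r (suc n)) f ≡
    sum (λ c → ∑ (colourings r n) (λ χ → f (c ∷ χ)))
  ∑-colourings r n f = trans (∑-cartesianProductWith _∷_ (allFin r) (colourings r n) f)
    (∑-tabulate (λ c → c) (λ c → ∑ (colourings r n) (λ χ → f (c ∷ χ))))

  sum-const : ∀ r c → sum {r} (λ _ → c) ≡ r * c
  sum-const zero    c = refl
  sum-const (suc r) c = cong (c +_) (sum-const r c)

  sum-members : ∀ {r} (A : Subset r) c → sum (λ i → if lookup A i then c else 0) ≡ ∣ A ∣ * c
  sum-members []            c = refl
  sum-members (inside ∷ A)  c = cong (c +_) (sum-members A c)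
  sum-members (outside ∷ A) c = sum-members A c

  length-colourings : ∀ r n → length (colourings r n) ≡ r ^ n
  length-colourings r n = begin
    length (colourings r n)          ≡⟨ *-identityʳ _ ⟨
    length (colourings r n) * 1      ≡⟨ ∑-const (colourings r n) 1 ⟨
    ∑ (colourings r n) (λ _ → 1)     ≡⟨ ones n ⟩
    r ^ n                            ∎
    where
    open ≡-Reasoning
    ones : ∀ n → ∑ (colourings r n) (λ _ → 1) ≡ r ^ n
    ones zero    = refl
    ones (suc n) = trans (∑-colourings r n (λ _ → 1)) (trans (sum-const r _) (cong (r *_) (ones n)))

  rainbows : ∀ {r n} → Subset r → Subset n → ℕ
  rainbows A I = ∑ (colourings _ _) (λ χ → indicator (rainbow A I χ))

  -- The entries in `I` use up the colours of `A` in `∣ A ∣ !` ways and the other entries are free;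
  -- the power of `r` on the left replaces the exponent `n − ∣ I ∣`. The set `A` varies because
  -- every entry in `I` removes its colour.
  rainbows-count : ∀ {r n} (A : Subset r) (I : Subset n) → ∣ A ∣ ≡ ∣ I ∣ →
    rainbows A I * r ^ ∣ I ∣ ≡ ∣ A ∣ ! * r ^ n
  rainbows-count A [] eq rewrite eq = refl
  rainbows-count {r} {suc n} A (outside ∷ I) eq = begin
    rainbows A (outside ∷ I) * r ^ ∣ I ∣ ≡⟨ cong (_* r ^ ∣ I ∣) (trans (∑-colourings r n _) (sum-const r (rainbows A I))) ⟩
    r * rainbows A I * r ^ ∣ I ∣         ≡⟨ *-assoc r _ _ ⟩
    r * (rainbows A I * r ^ ∣ I ∣)       ≡⟨ cong (r *_) (rainbows-count A I eq) ⟩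
    r * (∣ A ∣ ! * r ^ n)                ≡⟨ lemma r (∣ A ∣ !) (r ^ n) ⟩
    ∣ A ∣ ! * r ^ suc n                  ∎
    where
    open ≡-Reasoning
    lemma : ∀ x y z → x * (y * z) ≡ y * (x * z)
    lemma = solve-∀
  rainbows-count {r} {suc n} A (inside ∷ I) eq = begin
    rainbows A (inside ∷ I) * r ^ suc ∣ I ∣
      ≡⟨ cong (_* r ^ suc ∣ I ∣) (∑-colourings r n (λ χ → indicator (rainbow A (inside ∷ I) χ))) ⟩
    sum (λ c → part c) * r ^ suc ∣ I ∣
      ≡⟨ *-distribʳ-sum (r ^ suc ∣ I ∣) part ⟩
    sum (λ c → part c * r ^ suc ∣ I ∣)
      ≡⟨ sum-cong-≗ step ⟩
    sum (λ c → if lookup A c then ∣ I ∣ ! * r ^ suc n else 0)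
      ≡⟨ sum-members A _ ⟩
    ∣ A ∣ * (∣ I ∣ ! * r ^ suc n)
      ≡⟨ *-assoc ∣ A ∣ (∣ I ∣ !) _ ⟨
    ∣ A ∣ * ∣ I ∣ ! * r ^ suc n
      ≡⟨ cong (_* r ^ suc n) fact ⟩
    ∣ A ∣ ! * r ^ suc n ∎
    where
    open ≡-Reasoning
    part : Fin r → ℕ
    part c = ∑ (colourings r n) (λ χ → indicator (lookup A c ∧ rainbow (A [ c ]≔ outside) I χ))
    fact : ∣ A ∣ * ∣ I ∣ ! ≡ ∣ A ∣ !
    fact rewrite eq = refl
    lemma : ∀ x y z → x * (y * z) ≡ y * (x * z)
    lemma = solve-∀
    step : ∀ c → part c * r ^ suc ∣ I ∣ ≡ (if lookup A c then ∣ I ∣ ! * r ^ suc n else 0)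
    step c with lookup A c in c∈A
    ... | false = cong (_* r ^ suc ∣ I ∣) (∑-zero (colourings r n))
    ... | true  = begin
      rainbows A′ I * (r * r ^ ∣ I ∣) ≡⟨ lemma (rainbows A′ I) r _ ⟩
      r * (rainbows A′ I * r ^ ∣ I ∣) ≡⟨ cong (r *_) (rainbows-count A′ I ∣A′∣) ⟩
      r * (∣ A′ ∣ ! * r ^ n)          ≡⟨ lemma r (∣ A′ ∣ !) _ ⟩
      ∣ A′ ∣ ! * (r * r ^ n)          ≡⟨ cong (λ z → z ! * (r * r ^ n)) ∣A′∣ ⟩
      ∣ I ∣ ! * (r * r ^ n)           ∎
      where
      A′ : Subset r
      A′ = A [ c ]≔ outside
      ∣A′∣ : ∣ A′ ∣ ≡ ∣ I ∣
      ∣A′∣ = suc-injective (trans (sym (∣[]≔outside∣ A c c∈A)) eq)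

  ∈-allSubsets : ∀ {n} (I : Subset n) → I ∈ allSubsets n
  ∈-allSubsets []            = here refl
  ∈-allSubsets (outside ∷ I) = ∈-++⁺ˡ (∈-map⁺ (outside ∷_) (∈-allSubsets I))
  ∈-allSubsets (inside ∷ I)  = ∈-++⁺ʳ (List.map (outside ∷_) (allSubsets _)) (∈-map⁺ (inside ∷_) (∈-allSubsets I))

  -- By Pascal's rule, since `(n + 1)ʳ⁺¹ + (n + 1)ʳ = (n + 2)(n + 1)ʳ ≤ (n +
  -- 2)ʳ⁺¹`. A bound polynomial in `n` is what makes the number of colourings logarithmic.
  length-subsetsOfSize : ∀ n r → length (subsetsOfSize n r) ≤ suc n ^ r
  length-subsetsOfSize n r = subst (_≤ suc n ^ r) (sym (length≡∑ (allSubsets n))) (bound n r)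
    where
    size? : ∀ {n} r → Subset n → Bool
    size? r I = does (∣ I ∣ ≟ r)
    length≡∑ : ∀ {n r} (xs : List (Subset n)) → length (List.filter (λ I → ∣ I ∣ ≟ r) xs) ≡
      ∑ xs (λ I → indicator (size? r I))
    length≡∑ []       = refl
    length≡∑ {r = r} (I ∷ xs) with size? r I
    ... | true  = cong suc (length≡∑ xs)
    ... | false = length≡∑ xs
    split : ∀ n r → ∑ (allSubsets (suc n)) (λ I → indicator (size? r I)) ≡
      ∑ (allSubsets n) (λ I → indicator (size? r I)) + ∑ (allSubsets n) (λ I → indicator (size? r (inside ∷ I)))
    split n r = trans (∑-++ (List.map (outside ∷_) (allSubsets n)) _ (λ I → indicator (size? r I)))
      (cong₂ _+_ (∑-map (outside ∷_) (allSubsets n) _) (∑-map (inside ∷_) (allSubsets n) _))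
    bound : ∀ n r → ∑ (allSubsets n) (λ I → indicator (size? r I)) ≤ suc n ^ r
    bound zero    zero    = ≤-refl
    bound zero    (suc r) = z≤n
    bound (suc n) zero    = subst (_≤ 1) (sym (split n 0)) (≤-trans
      (+-mono-≤ (bound n 0) (≤-reflexive (∑-zero (allSubsets n)))) ≤-refl)
    bound (suc n) (suc r) = begin
      ∑ (allSubsets (suc n)) (λ I → indicator (size? (suc r) I)) ≡⟨ split n (suc r) ⟩
      _                          ≤⟨ +-mono-≤ (bound n (suc r)) (bound n r) ⟩
      suc n ^ suc r + suc n ^ r  ≡⟨ +-comm (suc n ^ suc r) _ ⟩
      suc (suc n) * suc n ^ r    ≤⟨ *-monoʳ-≤ (suc (suc n)) (^-monoˡ-≤ r (n≤1+n (suc n))) ⟩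
      suc (suc n) ^ suc r        ∎
      where open ≤-Reasoning

  m!≤n^m : ∀ {m n} → m ≤ n → m ! ≤ n ^ m
  m!≤n^m {zero}  _   = ≤-refl
  m!≤n^m {suc m} m<n = *-mono-≤ m<n (m!≤n^m (<⇒≤ m<n))

  product-scale : ∀ x y {k} (g : Fin k → ℕ) →
    product {k} (λ i → x * g i * y) ≡ x ^ k * product g * y ^ k
  product-scale x y {zero}  g = refl
  product-scale x y {suc k} g = trans (cong (x * g zero * y *_) (product-scale x y (g ∘ suc)))
    (lemma x (g zero) y (x ^ k) (product (g ∘ suc)) (y ^ k))
    where
    lemma : ∀ x g y X G Y → x * g * y * (X * G * Y) ≡ x * X * (g * G) * (y * Y)
    lemma = solve-∀

  count-not : ∀ {k} (R : Fin k → Bool) → count R + count (not ∘ R) ≡ k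
  count-not {zero}  R = refl
  count-not {suc k} R with R zero
  ... | true  = cong suc (count-not (R ∘ suc))
  ... | false = trans (+-suc (count (R ∘ suc)) _) (cong suc (count-not (R ∘ suc)))

  ∑-not : ∀ {A : Set} (xs : List A) R →
    ∑ xs (indicator ∘ R) + ∑ xs (indicator ∘ not ∘ R) ≡ length xs
  ∑-not []       R = refl
  ∑-not (x ∷ xs) R with R x
  ... | true  = cong suc (∑-not xs R)
  ... | false = trans (+-suc (∑ xs (indicator ∘ R)) _) (cong suc (∑-not xs R))

  -- `weight D` is `D` plus an indicator, and averaging turns the indicator into the probability
  -- `p/b`. The constant `Z` leaves room for a normalising factor.
  ∑-weight : ∀ {A : Set} (xs : List A) R p b D Z → ∑ xs (indicator ∘ R) * b ≡ p * length xs →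
    ∑ xs (λ x → b * weight D (R x) * Z) ≡ length xs * ((b * D + p) * Z)
  ∑-weight xs R p b D Z eq = begin
    ∑ xs (λ x → b * weight D (R x) * Z)
      ≡⟨ ∑-cong xs (λ x → expand (R x)) ⟩
    ∑ xs (λ x → b * D * Z + b * Z * indicator (R x))
      ≡⟨ ∑-distrib-+ xs (λ _ → b * D * Z) (λ x → b * Z * indicator (R x)) ⟩
    ∑ xs (λ _ → b * D * Z) + ∑ xs (λ x → b * Z * indicator (R x))
      ≡⟨ cong₂ _+_ (∑-const xs _) (sym (*-distribˡ-∑ (b * Z) xs (indicator ∘ R))) ⟩
    length xs * (b * D * Z) + b * Z * ∑ xs (indicator ∘ R)
      ≡⟨ cong (length xs * (b * D * Z) +_) (trans (lemma₁ b Z (∑ xs (indicator ∘ R))) (cong (Z *_) eq)) ⟩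
    length xs * (b * D * Z) + Z * (p * length xs)
      ≡⟨ lemma₂ (length xs) b D Z p ⟩
    length xs * ((b * D + p) * Z) ∎
    where
    open ≡-Reasoning
    lemma₁ : ∀ b Z S → b * Z * S ≡ Z * (S * b)
    lemma₁ = solve-∀
    lemma₂ : ∀ l b D Z p → l * (b * D * Z) + Z * (p * l) ≡ l * ((b * D + p) * Z)
    lemma₂ = solve-∀
    lemma₃ : ∀ b D Z → b * suc D * Z ≡ b * D * Z + b * Z * 1
    lemma₃ = solve-∀
    lemma₄ : ∀ b D Z → b * D * Z ≡ b * D * Z + b * Z * 0
    lemma₄ = solve-∀
    expand : ∀ s → b * weight D s * Z ≡ b * D * Z + b * Z * indicator s
    expand true  = lemma₃ b D Z
    expand false = lemma₄ b D Z

-- Colourings that make all `r`-sets rainbow nearly equally often.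

module Balanced where
  open import Data.Nat.Base
  open import Data.Nat.Properties
  open Derandomisation
  open Tail
  open Rainbow
  open RawSemiringDefinitions +-*-rawSemiring using (product)
  open ≤-Reasoning

  length-cartesianProduct : ∀ {A B : Set} (xs : List A) (ys : List B) →
    length (cartesianProduct xs ys) ≡ length xs * length ys
  length-cartesianProduct []       ys = refl
  length-cartesianProduct (x ∷ xs) ys = trans (length-++ (List.map (λ y → x , y) ys))
    (cong₂ _+_ (length-map (λ y → x , y) ys) (length-cartesianProduct xs ys))

  module _ (r h : ℕ) {{_ : NonZero r}} where
    private
      -- r!/rʳ = a/b is expanded by m because the tail bounds only confine the counts to
      -- multiples of [a − 1 , a + 1], and (a − 1)/(a + 1) ≥ h/(h + 1) needs a ≥ 2h + 1.
      m a b D : ℕ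
      m = suc (h + h)
      a = r ! * m
      b = r ^ r * m
      -- `growth` needs `D ≥ q² + q + 1` for the numerator `q` of each event; as `q ≤ b`, one `D`
      -- serves an event and its complement.
      D = b * b + b + 1
      instance
        b≢0 : NonZero b
        b≢0 = m*n≢0 (r ^ r) m {{m^n≢0 r r}}
        D≢0 : NonZero D
        D≢0 = >-nonZero (m≤n+m 1 (b * b + b))

      -- s selects between the event of being rainbow, of probability a/b, and its complement.
      num : Bool → ℕ
      num s = if s then a else b ∸ a

      a≤b : a ≤ b
      a≤b = *-monoˡ-≤ m (m!≤n^m {r} ≤-refl)

      num≤b : ∀ s → num s ≤ b
      num≤b true  = a≤b
      num≤b false = m∸n≤m b a

      large : ∀ s → num s * num s + num s + 1 ≤ D
      large s = +-monoˡ-≤ 1 (+-mono-≤ (*-mono-≤ (num≤b s) (num≤b s)) (num≤b s))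

      M : Bool → ℕ
      M s = b * D + num s

      M≢0 : ∀ s → NonZero (M s)
      M≢0 s = >-nonZero (≤-trans (>-nonZero⁻¹ (b * D) {{m*n≢0 b D}}) (m≤m+n (b * D) (num s)))

    per-round : ℕ
    per-round = D * D * b

    per-round≢0 : NonZero per-round
    per-round≢0 = m*n≢0 (D * D) b {{m*n≢0 D D}}

    module _ (n : ℕ) where
      private
        X : List (Vec (Fin r) n)
        X = colourings r n
        instance
          X≢0 : NonZero (length X)
          X≢0 = subst NonZero (sym (length-colourings r n)) (m^n≢0 r n)

        event : Bool → Subset n → Vec (Fin r) n → Bool
        event s I χ = if s then rainbow ⊤ I χ else not (rainbow ⊤ I χ)

        items : List (Bool × Subset n)
        items = cartesianProduct (true ∷ false ∷ []) (subsetsOfSize n r)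

        -- The first two factors have mean `M s`. The extra `M (not s)` gives all items the common
        -- mean `M true * M false`, because `greedy` works with a single `M`; it is cancelled again
        -- in `upper`.
        factor : Bool × Subset n → Vec (Fin r) n → ℕ
        factor (s , I) χ = b * weight D (event s I χ) * M (not s)

        probability : ∀ s I → ∣ I ∣ ≡ r → ∑ X (indicator ∘ event s I) * b ≡ num s * length X
        probability true I ∣I∣≡r = begin-equality
          rainbows ⊤ I * (r ^ r * m)            ≡⟨ *-assoc (rainbows ⊤ I) (r ^ r) m ⟨
          rainbows ⊤ I * r ^ r * m              ≡⟨ cong (λ z → rainbows ⊤ I * r ^ z * m) ∣I∣≡r ⟨
          rainbows ⊤ I * r ^ ∣ I ∣ * m          ≡⟨ cong (_* m) (rainbows-count ⊤ I (trans (∣⊤∣≡n r) (sym ∣I∣≡r))) ⟩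
          ∣ ⊤ {r} ∣ ! * r ^ n * m               ≡⟨ cong (λ z → z ! * r ^ n * m) (∣⊤∣≡n r) ⟩
          r ! * r ^ n * m                       ≡⟨ cong (λ z → r ! * z * m) (length-colourings r n) ⟨
          r ! * length X * m                    ≡⟨ lemma (r !) (length X) m ⟩
          r ! * m * length X                    ∎
          where
          lemma : ∀ x y z → x * y * z ≡ x * z * y
          lemma = solve-∀
        probability false I ∣I∣≡r = +-cancelˡ-≡ (a * length X) _ _ (begin-equality
          a * length X + N * b                   ≡⟨ cong (_+ N * b) (probability true I ∣I∣≡r) ⟨
          ∑ X (indicator ∘ event true I) * b + N * b ≡⟨ *-distribʳ-+ b (∑ X (indicator ∘ event true I)) N ⟨
          (∑ X (indicator ∘ event true I) + N) * b ≡⟨ cong (_* b) (∑-not X (rainbow ⊤ I)) ⟩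
          length X * b                           ≡⟨ *-comm (length X) b ⟩
          b * length X                           ≡⟨ cong (_* length X) (m+[n∸m]≡n a≤b) ⟨
          (a + (b ∸ a)) * length X               ≡⟨ *-distribʳ-+ (length X) a (b ∸ a) ⟩
          a * length X + (b ∸ a) * length X      ∎)
          where
          N : ℕ
          N = ∑ X (indicator ∘ event false I)

        M*M-not : ∀ s → M s * M (not s) ≡ M true * M false
        M*M-not true  = refl
        M*M-not false = *-comm (M false) (M true)

        mean : ∀ j → j ∈ items → ∑ X (factor j) ≤ length X * (M true * M false)
        mean (s , I) j∈ = begin
          ∑ X (λ χ → b * weight D (event s I χ) * M (not s))
            ≡⟨ ∑-weight X (event s I) (num s) b D (M (not s)) (probability s I ∣I∣≡r) ⟩
          length X * (M s * M (not s))     ≡⟨ cong (length X *_) (M*M-not s) ⟩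
          length X * (M true * M false)    ∎
          where
          ∣I∣≡r : ∣ I ∣ ≡ r
          ∣I∣≡r = proj₂ (∈-filter⁻ (λ I → ∣ I ∣ ≟ r) {xs = allSubsets n}
            (proj₂ (∈-cartesianProduct⁻ (true ∷ false ∷ []) (subsetsOfSize n r) j∈)))

        length-items : length items ≡ 2 * length (subsetsOfSize n r)
        length-items = length-cartesianProduct (true ∷ false ∷ []) (subsetsOfSize n r)

        ∈-items : ∀ s I → ∣ I ∣ ≡ r → (s , I) ∈ items
        ∈-items s I ∣I∣≡r = ∈-cartesianProduct⁺ (∈-bools s)
          (∈-filter⁺ (λ I → ∣ I ∣ ≟ r) (∈-allSubsets I) ∣I∣≡r)
          where
          ∈-bools : ∀ s → s ∈ true ∷ false ∷ []
          ∈-bools true  = here refl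
          ∈-bools false = there (here refl)

      -- The upper tails of the event and of its complement confine every count to
      -- `[k′(a − 1) , k′(a + 1)]`. The upper end is named `suc C` so that `recip C` is its
      -- reciprocal.
      balanced : ∀ t {{_ : NonZero t}} → 2 * length (subsetsOfSize n r) < 2 ^ t →
        ∃[ C ] ∃[ k ] k ≡ per-round * t ×
        Σ[ χ ∈ (Fin k → Vec (Fin r) n) ] (∀ I → ∣ I ∣ ≡ r →
          let c = count (λ i → rainbow ⊤ I (χ i)) in c ≤ suc C × h * suc C ≤ suc h * c)
      balanced t few with greedy X items factor (M true * M false) mean (D * D * t * b)
      ... | χ , products = pred (k′ * suc a) , k , lemma (D * D) t b , χ , λ I ∣I∣≡r →
        subst (λ C → count (event true I ∘ χ) ≤ C × h * C ≤ suc h * count (event true I ∘ χ))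
          (sym (suc-pred (k′ * suc a) {{C≢0}}))
          (upper true I ∣I∣≡r , lower I (upper false I ∣I∣≡r))
        where
        lemma : ∀ x y z → x * y * z ≡ x * z * y
        lemma = solve-∀
        k′ k : ℕ
        k′ = D * D * t
        k = k′ * b
        C≢0 : NonZero (k′ * suc a)
        C≢0 = m*n≢0 k′ (suc a) {{m*n≢0 (D * D) t {{m*n≢0 D D}}}}
        upper : ∀ s I → ∣ I ∣ ≡ r → count (event s I ∘ χ) ≤ k′ * suc (num s)
        upper s I ∣I∣≡r = upper-tail (num s) b D (large s) (length items) t
          (subst (_< 2 ^ t) (sym length-items) few) (event s I ∘ χ)
          (*-cancelʳ-≤ _ _ (M (not s) ^ k) {{m^n≢0 (M (not s)) k {{M≢0 (not s)}}}} (begin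
            b ^ k * product {k} (weight D ∘ event s I ∘ χ) * M (not s) ^ k
              ≡⟨ product-scale b (M (not s)) {k} (weight D ∘ event s I ∘ χ) ⟨
            product {k} (factor (s , I) ∘ χ)
              ≤⟨ products (s , I) (∈-items s I ∣I∣≡r) ⟩
            length items * (M true * M false) ^ k
              ≡⟨ cong (λ z → length items * z ^ k) (M*M-not s) ⟨
            length items * (M s * M (not s)) ^ k
              ≡⟨ cong (length items *_) (^-distribʳ-* (M s) (M (not s)) k) ⟩
            length items * (M s ^ k * M (not s) ^ k)
              ≡⟨ *-assoc (length items) (M s ^ k) _ ⟨
            length items * M s ^ k * M (not s) ^ k ∎))
        lower : ∀ I → let c = count (event true I ∘ χ) in
          count (event false I ∘ χ) ≤ k′ * suc (b ∸ a) → h * (k′ * suc a) ≤ suc h * c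
        -- In essence `h(a + 1) ≤ (h + 1)(a − 1)`, with `suc h * k′` added to both sides so that
        -- `a − 1` never appears.
        lower I c′≤ = +-cancelʳ-≤ (suc h * k′) _ _ (begin
          h * (k′ * suc a) + suc h * k′   ≡⟨ lemma₁ h k′ a ⟩
          k′ * (h * a + suc (h + h))      ≤⟨ *-monoʳ-≤ k′ (+-monoʳ-≤ (h * a) m≤a) ⟩
          k′ * (h * a + a)                ≡⟨ lemma₂ h k′ a ⟩
          suc h * (k′ * a)                ≤⟨ *-monoʳ-≤ (suc h) k′a≤ ⟩
          suc h * (c + k′)                ≡⟨ *-distribˡ-+ (suc h) c k′ ⟩
          suc h * c + suc h * k′          ∎)
          where
          c c′ : ℕ
          c = count (event true I ∘ χ)
          c′ = count (event false I ∘ χ)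
          m≤a : m ≤ a
          m≤a = m≤n*m m (r !) {{r !≢0}}
          lemma₁ : ∀ h k a → h * (k * suc a) + suc h * k ≡ k * (h * a + suc (h + h))
          lemma₁ = solve-∀
          lemma₂ : ∀ h k a → k * (h * a + a) ≡ suc h * (k * a)
          lemma₂ = solve-∀
          lemma₃ : ∀ c k d → c + k * suc d ≡ c + k + k * d
          lemma₃ = solve-∀
          k′a≤ : k′ * a ≤ c + k′
          k′a≤ = +-cancelʳ-≤ (k′ * (b ∸ a)) _ _ (begin
            k′ * a + k′ * (b ∸ a)    ≡⟨ *-distribˡ-+ k′ a (b ∸ a) ⟨
            k′ * (a + (b ∸ a))       ≡⟨ cong (k′ *_) (m+[n∸m]≡n a≤b) ⟩
            k                        ≡⟨ count-not (event true I ∘ χ) ⟨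
            c + c′                   ≤⟨ +-monoʳ-≤ c c′≤ ⟩
            c + k′ * suc (b ∸ a)     ≡⟨ lemma₃ c k′ (b ∸ a) ⟩
            c + k′ + k′ * (b ∸ a)    ∎)

-- Expanding products of colour sums into square-free monomials.

module Expansion {c ℓ} (S : CommutativeSemiring c ℓ) where
  open CommutativeSemiring S hiding (zero) renaming (refl to ≈-refl; sym to ≈-sym; trans to ≈-trans)
  open SetoidReasoning setoid
  open CommutativeSemigroupProperties +-commutativeSemigroup using (x∙yz≈y∙xz)
  open CommutativeSemigroupProperties *-commutativeSemigroup using () renaming (x∙yz≈y∙xz to x*yz≈y*xz)
  open ListSum S
  open SemiringSum semiring using (sum; sum-cong-≋; *-distribˡ-sum; *-distribʳ-sum)
  open RawSemiringDefinitions rawSemiring using (product)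
  open Rainbow using (rainbow; rainbow-size)

  indicator : Bool → Carrier
  indicator b = if b then 1# else 0#

  -- Also applied to a set of colours in place of a set of variables: it then forms the partial
  -- products over colours on which `expand` recurses.
  monomial : ∀ {n} → Subset n → (Fin n → Carrier) → Carrier
  monomial I x = product (λ i → if lookup I i then x i else 1#)

  same : ∀ {r} → Fin r → Fin r → Bool
  same i j = does (i Fin.≟ j)

  colour-sum : ∀ {r n} → Vec (Fin r) n → (Fin n → Carrier) → Fin r → Carrier
  colour-sum χ x j = sum (λ i → indicator (same (lookup χ i) j) * x i)

  product-cong : ∀ {n} {f g : Fin n → Carrier} → (∀ i → f i ≈ g i) → product f ≈ product g
  product-cong {zero}  f≈g = ≈-refl
  product-cong {suc n} f≈g = *-cong (f≈g zero) (product-cong (f≈g ∘ suc))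

  monomial-cong : ∀ {r} (A : Subset r) {f g : Fin r → Carrier} → (∀ i → f i ≈ g i) →
    monomial A f ≈ monomial A g
  monomial-cong A {f} {g} f≈g = product-cong step
    where
    step : ∀ i → (if lookup A i then f i else 1#) ≈ (if lookup A i then g i else 1#)
    step i with lookup A i
    ... | true  = f≈g i
    ... | false = ≈-refl

  monomial-zero : ∀ {r} (A : Subset r) → monomial A (λ _ → 0#) ≈ indicator (∣ A ∣ ℕ.≡ᵇ 0)
  monomial-zero []            = ≈-refl
  monomial-zero (inside ∷ A)  = zeroˡ _
  monomial-zero (outside ∷ A) = ≈-trans (*-identityˡ _) (monomial-zero A)

  -- A product is affine in each factor, and `y` enters only the factor of index `c`, so just two
  -- terms arise; the second is absent when `c` lies outside `A`.
  monomial-bump : ∀ {r} (A : Subset r) c y (f : Fin r → Carrier) →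
    monomial A (λ j → indicator (same c j) * y + f j) ≈
    monomial A f + (if lookup A c then y * monomial (A [ c ]≔ outside) f else 0#)
  monomial-bump (s ∷ A) zero y f with s
  ... | inside  = begin
    (1# * y + f zero) * monomial A (λ j → 0# * y + f (suc j))
      ≈⟨ *-cong (+-congʳ (*-identityˡ y)) rest ⟩
    (y + f zero) * monomial A (f ∘ suc)
      ≈⟨ distribʳ _ y (f zero) ⟩
    y * monomial A (f ∘ suc) + f zero * monomial A (f ∘ suc)
      ≈⟨ +-comm _ _ ⟩
    f zero * monomial A (f ∘ suc) + y * monomial A (f ∘ suc)
      ≈⟨ +-congˡ (*-congˡ (*-identityˡ _)) ⟨
    f zero * monomial A (f ∘ suc) + y * (1# * monomial A (f ∘ suc)) ∎
    where
    rest : monomial A (λ j → 0# * y + f (suc j)) ≈ monomial A (f ∘ suc)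
    rest = monomial-cong A (λ j → ≈-trans (+-congʳ (zeroˡ y)) (+-identityˡ _))
  ... | outside = ≈-trans (*-congˡ (monomial-cong A (λ j → ≈-trans (+-congʳ (zeroˡ y)) (+-identityˡ _))))
    (≈-sym (+-identityʳ _))
  monomial-bump (s ∷ A) (suc c) y f = begin
    (if s then 0# * y + f zero else 1#) * monomial A (λ j → indicator (same c j) * y + f (suc j))
      ≈⟨ *-cong (head s) (monomial-bump A c y (f ∘ suc)) ⟩
    g * (monomial A (f ∘ suc) + (if lookup A c then y * monomial (A [ c ]≔ outside) (f ∘ suc) else 0#))
      ≈⟨ distribˡ g _ _ ⟩
    g * monomial A (f ∘ suc) + g * (if lookup A c then y * monomial (A [ c ]≔ outside) (f ∘ suc) else 0#)
      ≈⟨ +-congˡ tail ⟩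
    g * monomial A (f ∘ suc) + (if lookup A c then y * (g * monomial (A [ c ]≔ outside) (f ∘ suc)) else 0#) ∎
    where
    g : Carrier
    g = if s then f zero else 1#
    head : ∀ s → (if s then 0# * y + f zero else 1#) ≈ (if s then f zero else 1#)
    head true  = ≈-trans (+-congʳ (zeroˡ y)) (+-identityˡ _)
    head false = ≈-refl
    tail : g * (if lookup A c then y * monomial (A [ c ]≔ outside) (f ∘ suc) else 0#) ≈
      (if lookup A c then y * (g * monomial (A [ c ]≔ outside) (f ∘ suc)) else 0#)
    tail with lookup A c
    ... | true  = x*yz≈y*xz g y _
    ... | false = zeroʳ g

  ∑-allSubsets : ∀ n f → ∑ (allSubsets (suc n)) f ≈
    ∑ (allSubsets n) (f ∘ (outside ∷_)) + ∑ (allSubsets n) (f ∘ (inside ∷_))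
  ∑-allSubsets n f = ≈-trans (∑-++ (List.map (outside ∷_) (allSubsets n)) _ f)
    (+-cong (∑-map (outside ∷_) (allSubsets n) f) (∑-map (inside ∷_) (allSubsets n) f))

  -- The first variable lies in exactly one colour class, so `monomial-bump` splits the product into
  -- the subsets avoiding it and those containing it. The latter have used up its colour, which is
  -- why the claim is made for every `A`.
  expand : ∀ {r n} (A : Subset r) (χ : Vec (Fin r) n) x →
    monomial A (colour-sum χ x) ≈ ∑ (allSubsets n) (λ I → indicator (rainbow A I χ) * monomial I x)
  expand A []      x = ≈-trans (monomial-zero A) (≈-sym (≈-trans (+-identityʳ _) (*-identityʳ _)))
  expand {n = suc n} A (c ∷ χ) x = begin
    monomial A (λ j → indicator (same c j) * x zero + colour-sum χ (x ∘ suc) j)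
      ≈⟨ monomial-bump A c (x zero) (colour-sum χ (x ∘ suc)) ⟩
    monomial A (colour-sum χ (x ∘ suc)) +
      (if lookup A c then x zero * monomial (A [ c ]≔ outside) (colour-sum χ (x ∘ suc)) else 0#)
      ≈⟨ +-cong without with-zero ⟩
    ∑ (allSubsets n) (term ∘ (outside ∷_)) + ∑ (allSubsets n) (term ∘ (inside ∷_))
      ≈⟨ ∑-allSubsets n term ⟨
    ∑ (allSubsets (suc n)) term ∎
    where
    term : Subset (suc n) → Carrier
    term I = indicator (rainbow A I (c ∷ χ)) * monomial I x
    without : monomial A (colour-sum χ (x ∘ suc)) ≈ ∑ (allSubsets n) (term ∘ (outside ∷_))
    without = ≈-trans (expand A χ (x ∘ suc))
      (∑-cong (allSubsets n) (λ I → *-congˡ (≈-sym (*-identityˡ _))))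
    with-zero : (if lookup A c then x zero * monomial (A [ c ]≔ outside) (colour-sum χ (x ∘ suc)) else 0#) ≈
      ∑ (allSubsets n) (term ∘ (inside ∷_))
    with-zero with lookup A c
    ... | true  = begin
      x zero * monomial (A [ c ]≔ outside) (colour-sum χ (x ∘ suc))
        ≈⟨ *-congˡ (expand (A [ c ]≔ outside) χ (x ∘ suc)) ⟩
      x zero * ∑ (allSubsets n) (λ I → indicator (rainbow (A [ c ]≔ outside) I χ) * monomial I (x ∘ suc))
        ≈⟨ *-distribˡ-∑ (x zero) (allSubsets n) _ ⟩
      ∑ (allSubsets n) (λ I → x zero * (indicator (rainbow (A [ c ]≔ outside) I χ) * monomial I (x ∘ suc)))
        ≈⟨ ∑-cong (allSubsets n) (λ I → x*yz≈y*xz _ _ _) ⟩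
      ∑ (allSubsets n) (λ I → indicator (rainbow (A [ c ]≔ outside) I χ) * (x zero * monomial I (x ∘ suc))) ∎
    ... | false = ≈-sym (≈-trans (∑-cong (allSubsets n) (λ I → zeroˡ _)) (∑-zero (allSubsets n)))

  monomial-⊤ : ∀ {r} (f : Fin r → Carrier) → monomial ⊤ f ≈ product f
  monomial-⊤ {zero}  f = ≈-refl
  monomial-⊤ {suc r} f = *-congˡ (monomial-⊤ (f ∘ suc))

  ∑-filter : ∀ {A : Set} {P : A → Set} (P? : ∀ x → Dec (P x)) (xs : List A) f →
    (∀ x → ¬ P x → f x ≈ 0#) → ∑ (List.filter P? xs) f ≈ ∑ xs f
  ∑-filter P? []       f f≈0 = ≈-refl
  ∑-filter P? (x ∷ xs) f f≈0 with P? x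
  ... | yes _  = +-congˡ (∑-filter P? xs f f≈0)
  ... | no ¬Px = ≈-trans (∑-filter P? xs f f≈0) (≈-sym (≈-trans (+-congʳ (f≈0 x ¬Px)) (+-identityˡ _)))

  -- Only subsets of size `r` survive in `expand`, since by `rainbow-size` no other size can be
  -- rainbow for all `r` colours.
  product-colour-sums : ∀ {r n} (χ : Vec (Fin r) n) x → product (colour-sum χ x) ≈
    ∑ (subsetsOfSize n r) (λ I → indicator (rainbow ⊤ I χ) * monomial I x)
  product-colour-sums {r} {n} χ x = begin
    product (colour-sum χ x)    ≈⟨ monomial-⊤ (colour-sum χ x) ⟨
    monomial ⊤ (colour-sum χ x) ≈⟨ expand ⊤ χ x ⟩
    ∑ (allSubsets n) (λ I → indicator (rainbow ⊤ I χ) * monomial I x)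
      ≈⟨ ∑-filter (λ I → ∣ I ∣ ℕ.≟ r) (allSubsets n) _ vanish ⟨
    ∑ (subsetsOfSize n r) (λ I → indicator (rainbow ⊤ I χ) * monomial I x) ∎
    where
    vanish : ∀ I → ∣ I ∣ ≢ r → indicator (rainbow ⊤ I χ) * monomial I x ≈ 0#
    vanish I ≢ rewrite rainbow-size ⊤ I χ (λ eq → ≢ (trans (sym eq) (∣⊤∣≡n r))) = zeroˡ _

  -- The scalar is put into the form of one colour only, so no `r`-th root of it has to be taken.
  scaled-colour-sum : ∀ {r n} → Carrier → Vec (Fin r) n → Fin r → Fin n → Carrier
  scaled-colour-sum s χ zero    i = s * indicator (same (lookup χ i) zero)
  scaled-colour-sum s χ (suc j) i = indicator (same (lookup χ i) (suc j))

  ∑-sum : ∀ {A : Set} (xs : List A) {k} (f : A → Fin k → Carrier) →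
    sum (λ i → ∑ xs (λ x → f x i)) ≈ ∑ xs (λ x → sum (f x))
  ∑-sum xs {zero}  f = ≈-sym (∑-zero xs)
  ∑-sum xs {suc k} f = ≈-trans (+-congˡ (∑-sum xs (λ x → f x ∘ suc)))
    (≈-sym (∑-distrib-+ xs (λ x → f x zero) (λ x → sum (f x ∘ suc))))

  sum-of-products : ∀ {r n k} s (χ : Fin k → Vec (Fin (suc r)) n) x →
    sum (λ i → product (λ j → sum (λ l → scaled-colour-sum s (χ i) j l * x l))) ≈
    ∑ (subsetsOfSize n (suc r)) (λ I → s * sum (λ i → indicator (rainbow ⊤ I (χ i))) * monomial I x)
  sum-of-products {r} {n} {k} s χ x = begin
    sum (λ i → product (λ j → sum (λ l → scaled-colour-sum s (χ i) j l * x l)))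
      ≈⟨ sum-cong-≋ (λ i → scaled (χ i)) ⟩
    sum (λ i → s * product (colour-sum (χ i) x))
      ≈⟨ *-distribˡ-sum s (λ i → product (colour-sum (χ i) x)) ⟨
    s * sum (λ i → product (colour-sum (χ i) x))
      ≈⟨ *-congˡ (sum-cong-≋ (λ i → product-colour-sums (χ i) x)) ⟩
    s * sum (λ i → ∑ Is (λ I → indicator (rainbow ⊤ I (χ i)) * monomial I x))
      ≈⟨ *-congˡ (∑-sum Is (λ I i → indicator (rainbow ⊤ I (χ i)) * monomial I x)) ⟩
    s * ∑ Is (λ I → sum (λ i → indicator (rainbow ⊤ I (χ i)) * monomial I x))
      ≈⟨ *-distribˡ-∑ s Is _ ⟩
    ∑ Is (λ I → s * sum (λ i → indicator (rainbow ⊤ I (χ i)) * monomial I x))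
      ≈⟨ ∑-cong Is (λ I → ≈-trans (*-congˡ (≈-sym (*-distribʳ-sum (monomial I x) (λ i → indicator (rainbow ⊤ I (χ i)))))) (≈-sym (*-assoc s _ _))) ⟩
    ∑ Is (λ I → s * sum (λ i → indicator (rainbow ⊤ I (χ i))) * monomial I x) ∎
    where
    Is : List (Subset n)
    Is = subsetsOfSize n (suc r)
    scaled : ∀ χ → product (λ j → sum (λ l → scaled-colour-sum s χ j l * x l)) ≈ s * product (colour-sum χ x)
    scaled χ = ≈-trans (*-congʳ (≈-trans (sum-cong-≋ (λ l → *-assoc s _ (x l)))
      (≈-sym (*-distribˡ-sum s (λ l → indicator (same (lookup χ l) zero) * x l))))) (*-assoc s _ _)

-- Linearity of linear combinations over a commutative ring.

module LinearCombinations {c ℓ} (S : CommutativeRing c ℓ) where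
  open CommutativeRing S hiding (zero) renaming (sym to ≈-sym; trans to ≈-trans)
  open RingProperties ring using (-‿distribʳ-*; -‿+-comm; -0#≈0#)
  open CommutativeSemigroupProperties *-commutativeSemigroup using (x∙yz≈y∙xz)
  open SemiringSum semiring using (sum; sum-cong-≋; sum-replicate-zero; ∑-distrib-+; *-distribˡ-sum)

  combination : ∀ {n} → (Fin n → Carrier) → (Fin n → Carrier) → Carrier
  combination a x = sum (λ i → a i * x i)

  module _ {n} (a : Fin n → Carrier) where
    combination-+ : ∀ x y → combination a (λ i → x i + y i) ≈ combination a x + combination a y
    combination-+ x y = ≈-trans (sum-cong-≋ (λ i → distribˡ (a i) (x i) (y i)))
      (∑-distrib-+ (λ i → a i * x i) (λ i → a i * y i))

    combination-0 : combination a (λ _ → 0#) ≈ 0#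
    combination-0 = ≈-trans (sum-cong-≋ (λ i → zeroʳ (a i))) (sum-replicate-zero n)

    combination-* : ∀ y x → combination a (λ i → y * x i) ≈ y * combination a x
    combination-* y x = ≈-trans (sum-cong-≋ (λ i → x∙yz≈y∙xz (a i) y (x i)))
      (≈-sym (*-distribˡ-sum y (λ i → a i * x i)))

  combination-neg : ∀ {n} (a x : Fin n → Carrier) → combination a (λ i → - x i) ≈ - combination a x
  combination-neg {zero}  a x = ≈-sym -0#≈0#
  combination-neg {suc n} a x = ≈-trans
    (+-cong (≈-sym (-‿distribʳ-* (a zero) (x zero))) (combination-neg (a ∘ suc) (x ∘ suc)))
    (-‿+-comm (a zero * x zero) (combination (a ∘ suc) (x ∘ suc)))

open import Data.Integer.Base as ℤ using (+_; -[1+_])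
open import Defs

-- Naturals and their reciprocals inside ℚ.

module Rationals where
  open ℚ.≤-Reasoning
  open +-*-Solver

  ι : ℕ → ℚ
  ι n = + n ℚ./ 1

  recip : ℕ → ℚ
  recip n = + 1 ℚ./ suc n

  ιᵘ : ∀ n → ℚ.toℚᵘ (ι n) ℚᵘ.≃ mkℚᵘ (+ n) 0
  ιᵘ n = ℚ.toℚᵘ-fromℚᵘ (mkℚᵘ (+ n) 0)

  recipᵘ : ∀ n → ℚ.toℚᵘ (recip n) ℚᵘ.≃ mkℚᵘ (+ 1) n
  recipᵘ n = ℚ.toℚᵘ-fromℚᵘ (mkℚᵘ (+ 1) n)

  ι-suc : ∀ n → ι (suc n) ≡ 1ℚ ℚ.+ ι n
  ι-suc n = sym (ℚ.toℚᵘ-injective (ℚᵘ.≃-trans (ℚ.toℚᵘ-homo-+ 1ℚ (ι n))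
    (ℚᵘ.≃-trans (ℚᵘ.+-congʳ ℚᵘ.1ℚᵘ (ιᵘ n))
    (ℚᵘ.≃-trans (*≡* (cong (ℤ._* + 1) (cong (λ z → + 1 ℤ.+ z) (ℤ.*-identityʳ (+ n)))))
                (ℚᵘ.≃-sym (ιᵘ (suc n)))))))

  ι-+ : ∀ m n → ι (m ℕ.+ n) ≡ ι m ℚ.+ ι n
  ι-+ zero    n = sym (ℚ.+-identityˡ (ι n))
  ι-+ (suc m) n = trans (ι-suc (m ℕ.+ n)) (trans (cong (1ℚ ℚ.+_) (ι-+ m n))
    (trans (sym (ℚ.+-assoc 1ℚ (ι m) (ι n))) (cong (ℚ._+ ι n) (sym (ι-suc m)))))

  ι-* : ∀ m n → ι (m ℕ.* n) ≡ ι m ℚ.* ι n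
  ι-* zero    n = sym (ℚ.*-zeroˡ (ι n))
  ι-* (suc m) n = trans (ι-+ n (m ℕ.* n)) (trans (cong (ι n ℚ.+_) (ι-* m n))
    (trans (solve 2 (λ x y → y :+ x :* y := (con 1ℚ :+ x) :* y) refl (ι m) (ι n))
      (cong (ℚ._* ι n) (sym (ι-suc m)))))

  ι-nonNeg : ∀ n → ℚ.NonNegative (ι n)
  ι-nonNeg n = ℚ.normalize-nonNeg n 1

  ι-pos : ∀ n → ℚ.Positive (ι (suc n))
  ι-pos n = ℚ.normalize-pos (suc n) 1

  recip-nonNeg : ∀ n → ℚ.NonNegative (recip n)
  recip-nonNeg n = ℚ.normalize-nonNeg 1 (suc n)

  0≤ι : ∀ n → 0ℚ ℚ.≤ ι n
  0≤ι n = ℚ.nonNegative⁻¹ (ι n) {{ι-nonNeg n}}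

  ι-mono : ∀ {m n} → m ℕ.≤ n → ι m ℚ.≤ ι n
  ι-mono {m} m≤n with ℕ.m≤n⇒∃[o]m+o≡n m≤n
  ... | o , refl = begin
    ι m              ≡⟨ ℚ.+-identityʳ (ι m) ⟨
    ι m ℚ.+ 0ℚ       ≤⟨ ℚ.+-monoʳ-≤ (ι m) (0≤ι o) ⟩
    ι m ℚ.+ ι o      ≡⟨ ι-+ m o ⟨
    ι (m ℕ.+ o)      ∎

  ι*recip : ∀ n → ι (suc n) ℚ.* recip n ≡ 1ℚ
  ι*recip n = ℚ.toℚᵘ-injective (ℚᵘ.≃-trans (ℚ.toℚᵘ-homo-* (ι (suc n)) (recip n))
    (ℚᵘ.≃-trans (ℚᵘ.*-cong (ιᵘ (suc n)) (recipᵘ n)) (*≡* (cong +_ (eq n)))))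
    where
    eq : ∀ n → (suc n ℕ.* 1) ℕ.* 1 ≡ 1 ℕ.* (1 ℕ.* suc n)
    eq n = trans (ℕ.*-identityʳ (suc n ℕ.* 1)) (trans (ℕ.*-identityʳ (suc n))
      (sym (trans (ℕ.*-identityˡ (1 ℕ.* suc n)) (ℕ.*-identityˡ (suc n)))))

  recip-anti : ∀ {m n} → m ℕ.≤ n → recip n ℚ.≤ recip m
  recip-anti {m} {n} m≤n = ℚ.*-cancelˡ-≤-pos (ι (suc m)) {{ι-pos m}} (ℚ.*-cancelˡ-≤-pos (ι (suc n)) {{ι-pos n}} (begin
    ι (suc n) ℚ.* (ι (suc m) ℚ.* recip n)  ≡⟨ solve 3 (λ x y z → x :* (y :* z) := y :* (x :* z)) refl (ι (suc n)) (ι (suc m)) (recip n) ⟩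
    ι (suc m) ℚ.* (ι (suc n) ℚ.* recip n)  ≡⟨ cong (ι (suc m) ℚ.*_) (ι*recip n) ⟩
    ι (suc m) ℚ.* 1ℚ                       ≤⟨ ℚ.*-monoʳ-≤-nonNeg 1ℚ (ι-mono (ℕ.s≤s m≤n)) ⟩
    ι (suc n) ℚ.* 1ℚ                       ≡⟨ cong (ι (suc n) ℚ.*_) (ι*recip m) ⟨
    ι (suc n) ℚ.* (ι (suc m) ℚ.* recip m)  ∎))

  archimedean : ∀ q → ∃[ n ] q ℚ.≤ ι n
  archimedean q@(mkℚ (+ m) d _) = m , ℚ.toℚᵘ-cancel-≤ (ℚᵘ.≤-respʳ-≃ (ℚᵘ.≃-sym (ιᵘ m))
    (*≤* (ℤ.*-monoˡ-≤-nonNeg (+ m) {+ 1} {+ suc d} (ℤ.+≤+ (ℕ.s≤s ℕ.z≤n)))))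
  archimedean (mkℚ -[1+ m ] d _) = 0 , ℚ.*≤* ℤ.-≤+

  archimedean-recip : ∀ q → 0ℚ ℚ.< q → ∃[ n ] 1ℚ ℚ.≤ ι n ℚ.* q
  archimedean-recip q 0<q with archimedean (ℚ.1/_ q {{ℚ.>-nonZero 0<q}})
  ... | n , q⁻¹≤n = n , subst (ℚ._≤ ι n ℚ.* q) (ℚ.*-inverseˡ q {{ℚ.>-nonZero 0<q}})
    (ℚ.*-monoʳ-≤-nonNeg q {{ℚ.nonNegative (ℚ.<⇒≤ 0<q)}} q⁻¹≤n)

  ∣∣≤ : ∀ {p q} → p ℚ.≤ q → ℚ.- p ℚ.≤ q → ℚ.∣ p ∣ ℚ.≤ q
  ∣∣≤ {p} p≤q -p≤q with ℚ.∣p∣≡p∨∣p∣≡-p p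
  ... | inj₁ eq = subst (ℚ._≤ _) (sym eq) p≤q
  ... | inj₂ eq = subst (ℚ._≤ _) (sym eq) -p≤q

  ≤∣∣ : ∀ p → p ℚ.≤ ℚ.∣ p ∣
  ≤∣∣ (mkℚ (+ _) _ _)    = ℚ.≤-refl
  ≤∣∣ (mkℚ -[1+ _ ] _ _) = ℚ.*≤* ℤ.-≤+

  *-mono-≤-nonNeg : ∀ {p q r s} → ℚ.NonNegative r → ℚ.NonNegative q → p ℚ.≤ q → r ℚ.≤ s → p ℚ.* r ℚ.≤ q ℚ.* s
  *-mono-≤-nonNeg {p} {q} {r} {s} r≥0 q≥0 p≤q r≤s = ℚ.≤-trans
    (ℚ.*-monoʳ-≤-nonNeg r {{r≥0}} p≤q) (ℚ.*-monoˡ-≤-nonNeg q {{q≥0}} r≤s)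

  -- Every y > 0 satisfies |1 − y| < 1 + y; this is the uniform version on [δ , h] when h ≥ 1/δ.
  contraction : ∀ h δ y → 1ℚ ℚ.≤ ι h ℚ.* δ → δ ℚ.≤ y → y ℚ.≤ ι h →
    ι (suc h) ℚ.* ℚ.∣ 1ℚ ℚ.- y ∣ ℚ.≤ ι h ℚ.* (1ℚ ℚ.+ y)
  contraction h δ y 1≤hδ δ≤y y≤h = begin
    ι (suc h) ℚ.* ℚ.∣ 1ℚ ℚ.- y ∣            ≡⟨ cong (ℚ._* _) (ℚ.0≤p⇒∣p∣≡p (0≤ι (suc h))) ⟨
    ℚ.∣ ι (suc h) ∣ ℚ.* ℚ.∣ 1ℚ ℚ.- y ∣      ≡⟨ ℚ.∣p*q∣≡∣p∣*∣q∣ (ι (suc h)) (1ℚ ℚ.- y) ⟨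
    ℚ.∣ ι (suc h) ℚ.* (1ℚ ℚ.- y) ∣          ≡⟨ cong (λ z → ℚ.∣ z ℚ.* (1ℚ ℚ.- y) ∣) (ι-suc h) ⟩
    ℚ.∣ (1ℚ ℚ.+ ι h) ℚ.* (1ℚ ℚ.- y) ∣       ≤⟨ ∣∣≤ low high ⟩
    ι h ℚ.* (1ℚ ℚ.+ y)                      ∎
    where
    1≤hy : 1ℚ ℚ.≤ ι h ℚ.* y
    1≤hy = ℚ.≤-trans 1≤hδ (ℚ.*-monoˡ-≤-nonNeg (ι h) {{ι-nonNeg h}} δ≤y)
    0≤h : 0ℚ ℚ.≤ ι h
    0≤h = 0≤ι h
    0≤hy : 0ℚ ℚ.≤ ι h ℚ.* y
    0≤hy = ℚ.≤-trans (ℚ.nonNegative⁻¹ 1ℚ) 1≤hy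
    0≤y : 0ℚ ℚ.≤ y
    0≤y = ℚ.≮⇒≥ λ y<0 → ℚ.<-irrefl refl (ℚ.<-≤-trans (ℚ.positive⁻¹ 1ℚ) (ℚ.≤-trans 1≤hy
      (subst (ι h ℚ.* y ℚ.≤_) (ℚ.*-zeroʳ (ι h)) (ℚ.*-monoˡ-≤-nonNeg (ι h) {{ι-nonNeg h}} (ℚ.<⇒≤ y<0)))))
    -- After cancellation, `1 ≤ 2hy + y`.
    low : (1ℚ ℚ.+ ι h) ℚ.* (1ℚ ℚ.- y) ℚ.≤ ι h ℚ.* (1ℚ ℚ.+ y)
    low = begin
      (1ℚ ℚ.+ ι h) ℚ.* (1ℚ ℚ.- y)
        ≡⟨ solve 2 (λ h y → (con 1ℚ :+ h) :* (con 1ℚ :- y) := con 1ℚ :+ (h :- y :- h :* y)) refl (ι h) y ⟩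
      1ℚ ℚ.+ (ι h ℚ.- y ℚ.- ι h ℚ.* y)
        ≤⟨ ℚ.+-monoˡ-≤ (ι h ℚ.- y ℚ.- ι h ℚ.* y) (ℚ.+-mono-≤ (ℚ.+-mono-≤ 1≤hy 0≤hy) 0≤y) ⟩
      ι h ℚ.* y ℚ.+ ι h ℚ.* y ℚ.+ y ℚ.+ (ι h ℚ.- y ℚ.- ι h ℚ.* y)
        ≡⟨ solve 2 (λ h y → h :* y :+ h :* y :+ y :+ (h :- y :- h :* y) := h :* (con 1ℚ :+ y)) refl (ι h) y ⟩
      ι h ℚ.* (1ℚ ℚ.+ y) ∎
    -- After cancellation, `y ≤ 2h + 1`.
    high : ℚ.- ((1ℚ ℚ.+ ι h) ℚ.* (1ℚ ℚ.- y)) ℚ.≤ ι h ℚ.* (1ℚ ℚ.+ y)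
    high = begin
      ℚ.- ((1ℚ ℚ.+ ι h) ℚ.* (1ℚ ℚ.- y))
        ≡⟨ solve 2 (λ h y → :- ((con 1ℚ :+ h) :* (con 1ℚ :- y)) := y :+ con 0ℚ :+ con 0ℚ :+ (h :* y :- h :- con 1ℚ)) refl (ι h) y ⟩
      y ℚ.+ 0ℚ ℚ.+ 0ℚ ℚ.+ (ι h ℚ.* y ℚ.- ι h ℚ.- 1ℚ)
        ≤⟨ ℚ.+-monoˡ-≤ (ι h ℚ.* y ℚ.- ι h ℚ.- 1ℚ) (ℚ.+-mono-≤ (ℚ.+-mono-≤ y≤h 0≤h) (ℚ.nonNegative⁻¹ 1ℚ)) ⟩
      ι h ℚ.+ ι h ℚ.+ 1ℚ ℚ.+ (ι h ℚ.* y ℚ.- ι h ℚ.- 1ℚ)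
        ≡⟨ solve 2 (λ h y → h :+ h :+ con 1ℚ :+ (h :* y :- h :- con 1ℚ) := h :* (con 1ℚ :+ y)) refl (ι h) y ⟩
      ι h ℚ.* (1ℚ ℚ.+ y) ∎

-- A lower bound for the logarithm at powers of two.

module Logarithm where
  open Rationals
  open ℚ.≤-Reasoning

  Σ<-split : ∀ a b (f : ℕ → ℚ) → Σ< (a ℕ.+ b) f ≡ Σ< a f ℚ.+ Σ< b (λ j → f (a ℕ.+ j))
  Σ<-split zero    b f = sym (ℚ.+-identityˡ (Σ< b f))
  Σ<-split (suc a) b f = trans (cong (f 0 ℚ.+_) (Σ<-split a b (λ j → f (suc j))))
    (sym (ℚ.+-assoc (f 0) (Σ< a (λ j → f (suc j))) (Σ< b (λ j → f (suc a ℕ.+ j)))))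

  Σ<-cong : ∀ k {f g : ℕ → ℚ} → (∀ j → f j ≡ g j) → Σ< k f ≡ Σ< k g
  Σ<-cong zero    f≡g = refl
  Σ<-cong (suc k) f≡g = cong₂ ℚ._+_ (f≡g 0) (Σ<-cong k (λ j → f≡g (suc j)))

  Σ<-lower : ∀ k {f : ℕ → ℚ} {q} → (∀ j → j ℕ.< k → q ℚ.≤ f j) → ι k ℚ.* q ℚ.≤ Σ< k f
  Σ<-lower zero        {q = q} q≤f = ℚ.≤-reflexive (ℚ.*-zeroˡ q)
  Σ<-lower (suc k) {f} {q}     q≤f = begin
    ι (suc k) ℚ.* q             ≡⟨ cong (ℚ._* q) (ι-suc k) ⟩
    (1ℚ ℚ.+ ι k) ℚ.* q          ≡⟨ solve 2 (λ k q → (con 1ℚ :+ k) :* q := q :+ k :* q) refl (ι k) q ⟩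
    q ℚ.+ ι k ℚ.* q             ≤⟨ ℚ.+-mono-≤ (q≤f 0 (ℕ.s≤s ℕ.z≤n)) (Σ<-lower k (λ j j<k → q≤f (suc j) (ℕ.s≤s j<k))) ⟩
    f 0 ℚ.+ Σ< k (λ j → f (suc j)) ∎
    where open +-*-Solver

  -- With mesh `1/M`, the interval from 1 to `2ˡ` has `(2ˡ − 1)M` terms. The recursion says that one
  -- block of `M` terms, followed by `2ˡ − 1` blocks of `2M`, makes up the count for `l + 1`.
  2^[_]∸1 : ℕ → ℕ
  2^[ zero  ]∸1 = 0
  2^[ suc l ]∸1 = suc (2 ℕ.* 2^[ l ]∸1)

  suc-2^∸1 : ∀ l → suc (2^[ l ]∸1) ≡ 2 ℕ.^ l
  suc-2^∸1 zero    = refl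
  suc-2^∸1 (suc l) = trans (sym (ℕ.*-suc 2 (2^[ l ]∸1))) (cong (2 ℕ.*_) (suc-2^∸1 l))

  -- The dyadic block [M , 2M) contributes at least M · 1/2M, and the rest is a sum of the same shape for 2M.
  Σ<-recip-lower : ∀ l m k → 2^[ l ]∸1 ℕ.* suc m ℕ.≤ k → ι l ℚ.* ½ ℚ.≤ Σ< k (λ j → recip (m ℕ.+ j))
  Σ<-recip-lower zero    m k _ = subst (ℚ._≤ Σ< k (λ j → recip (m ℕ.+ j))) (trans (ℚ.*-zeroʳ (ι k)) (sym (ℚ.*-zeroˡ ½)))
    (Σ<-lower k (λ j _ → ℚ.nonNegative⁻¹ (recip (m ℕ.+ j)) {{recip-nonNeg (m ℕ.+ j)}}))
  Σ<-recip-lower (suc l) m k long with ℕ.m≤n⇒∃[o]m+o≡n (ℕ.≤-trans (ℕ.m≤m+n (suc m) _) long)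
  ... | k′ , refl = begin
    ι (suc l) ℚ.* ½                   ≡⟨ cong (ℚ._* ½) (ι-suc l) ⟩
    (1ℚ ℚ.+ ι l) ℚ.* ½                ≡⟨ solve 1 (λ l → (con 1ℚ :+ l) :* con ½ := con ½ :+ l :* con ½) refl (ι l) ⟩
    ½ ℚ.+ ι l ℚ.* ½                   ≤⟨ ℚ.+-mono-≤ block (Σ<-recip-lower l m′ k′ long′) ⟩
    Σ< (suc m) (λ j → recip (m ℕ.+ j)) ℚ.+ Σ< k′ (λ j → recip (m′ ℕ.+ j))
      ≡⟨ cong (Σ< (suc m) (λ j → recip (m ℕ.+ j)) ℚ.+_) (Σ<-cong k′ (λ j → cong recip (ℕ.+-assoc m (suc m) j))) ⟩
    Σ< (suc m) (λ j → recip (m ℕ.+ j)) ℚ.+ Σ< k′ (λ j → recip (m ℕ.+ (suc m ℕ.+ j)))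
      ≡⟨ Σ<-split (suc m) k′ (λ j → recip (m ℕ.+ j)) ⟨
    Σ< (suc m ℕ.+ k′) (λ j → recip (m ℕ.+ j)) ∎
    where
    open +-*-Solver
    m′ : ℕ
    m′ = m ℕ.+ suc m
    suc-m′ : suc m′ ≡ 2 ℕ.* suc m
    suc-m′ = cong (λ z → suc m ℕ.+ z) (sym (ℕ.+-identityʳ (suc m)))
    long′ : 2^[ l ]∸1 ℕ.* suc m′ ℕ.≤ k′
    long′ = ℕ.+-cancelˡ-≤ (suc m) _ _ (subst (ℕ._≤ suc m ℕ.+ k′) (cong (suc m ℕ.+_) eq) long)
      where
      eq : 2 ℕ.* 2^[ l ]∸1 ℕ.* suc m ≡ 2^[ l ]∸1 ℕ.* suc m′
      eq = trans (cong (ℕ._* suc m) (ℕ.*-comm 2 (2^[ l ]∸1)))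
        (trans (ℕ.*-assoc (2^[ l ]∸1) 2 (suc m)) (cong (2^[ l ]∸1 ℕ.*_) (sym suc-m′)))
    half : ι (suc m) ℚ.* recip m′ ≡ ½
    half = ℚ.≤-antisym (ℚ.*-cancelˡ-≤-pos (ι 2) {{ι-pos 1}} (ℚ.≤-reflexive double)) (ℚ.*-cancelˡ-≤-pos (ι 2) {{ι-pos 1}} (ℚ.≤-reflexive (sym double)))
      where
      double : ι 2 ℚ.* (ι (suc m) ℚ.* recip m′) ≡ ι 2 ℚ.* ½
      double = trans (sym (ℚ.*-assoc (ι 2) (ι (suc m)) (recip m′)))
        (trans (cong (ℚ._* recip m′) (trans (sym (ι-* 2 (suc m))) (cong ι (sym suc-m′)))) (ι*recip m′))
    block : ½ ℚ.≤ Σ< (suc m) (λ j → recip (m ℕ.+ j))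
    block = subst (ℚ._≤ Σ< (suc m) (λ j → recip (m ℕ.+ j))) half
      (Σ<-lower (suc m) (λ j j≤m → recip-anti (ℕ.+-monoʳ-≤ m (ℕ.<⇒≤ j≤m))))

  -- The lower bound on `n` serves the logarithm; the upper one is stated for `suc n` because
  -- `length-subsetsOfSize` is a power of `suc n`.
  dyadic : ∀ n → 1 ℕ.≤ n → ∃[ l ] (2 ℕ.^ l ℕ.≤ n × suc n ℕ.≤ 2 ℕ.^ suc l)
  dyadic (suc zero)    _ = 0 , ℕ.≤-refl , ℕ.≤-refl
  dyadic (suc (suc n)) _ with dyadic (suc n) (ℕ.s≤s ℕ.z≤n)
  ... | l , 2^l≤n , n<2^l with ℕ.m≤n⇒m<n∨m≡n n<2^l
  ... | inj₁ lt = l , ℕ.m≤n⇒m≤1+n 2^l≤n , lt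
  ... | inj₂ eq = suc l , ℕ.≤-reflexive (sym eq) , subst (suc (suc (suc n)) ℕ.≤_)
    (cong (2 ℕ.*_) eq) (ℕ.s≤s (ℕ.s≤s (ℕ.≤-trans (ℕ.m≤n+m (suc n) n) (ℕ.+-monoʳ-≤ n (ℕ.≤-trans (ℕ.n≤1+n (suc n)) (ℕ.m≤m+n (suc (suc n)) 0))))))

  -- The bound `l/2` for `ln n` already holds for every Riemann sum, so real inequalities can be
  -- checked entry by entry.
  riemann-lower : ∀ n l m → 2 ℕ.^ l ℕ.≤ n → ι l ℚ.* ½ ℚ.≤ riemann (n ℕ.∸ 1) m
  riemann-lower zero    l m le = Σ<-recip-lower l m 0 (subst (λ z → z ℕ.* suc m ℕ.≤ 0) (sym (impossible le)) ℕ.z≤n)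
    where
    impossible : 2 ℕ.^ l ℕ.≤ 0 → 2^[ l ]∸1 ≡ 0
    impossible le with subst (ℕ._≤ 0) (sym (suc-2^∸1 l)) le
    ... | ()
  riemann-lower (suc n) l m le = Σ<-recip-lower l m (n ℕ.* suc m)
    (ℕ.*-monoˡ-≤ (suc m) (ℕ.s≤s⁻¹ (subst (ℕ._≤ suc n) (sym (suc-2^∸1 l)) le)))

-- Transfer from rational sequences to the reals.

module Reals where
  open Rationals
  open Tail using (count)
  open Rainbow using (rainbow)

  ℚ-semiring : CommutativeSemiring 0ℓ 0ℓ
  ℚ-semiring = CommutativeRing.commutativeSemiring ℚ.+-*-commutativeRing

  open ListSum ℚ-semiring using (∑; ∑-cong)
  open SemiringSum (CommutativeSemiring.semiring ℚ-semiring) using () renaming (sum to sumℚ; sum-cong-≗ to sumℚ-cong)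
  open RawSemiringDefinitions (CommutativeSemiring.rawSemiring ℚ-semiring) using () renaming (product to productℚ)
  module ℚ[x] = Expansion ℚ-semiring
  open LinearCombinations ℚ.+-*-commutativeRing

  -- Real sums and products are computed entrywise, so polynomial identities over ℚ pass to ℝ
  -- through this lemma, without ring laws for `≈`.
  termwise : ∀ x y → (∀ t → seq x t ≡ seq y t) → x ≈ y
  termwise x y x≐y ε 0<ε = 0 , λ t _ → subst (λ z → ℚ.∣ seq x t ℚ.- z ∣ ℚ.≤ ε) (x≐y t)
    (subst (ℚ._≤ ε) (sym (cong ℚ.∣_∣ (ℚ.+-inverseʳ (seq x t)))) (ℚ.<⇒≤ 0<ε))

  seq-sum : ∀ {n} (f : Fin n → ℝ) t → seq (sum f) t ≡ sumℚ (λ i → seq (f i) t)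
  seq-sum {zero}  f t = refl
  seq-sum {suc n} f t = cong (seq (f zero) t ℚ.+_) (seq-sum (f ∘ suc) t)

  seq-product : ∀ {n} (f : Fin n → ℝ) t → seq (product f) t ≡ productℚ (λ i → seq (f i) t)
  seq-product {zero}  f t = refl
  seq-product {suc n} f t = cong (seq (f zero) t ℚ.*_) (seq-product (f ∘ suc) t)

  seq-foldr : ∀ {A : Set} (xs : List A) (f : A → ℝ) t →
    seq (List.foldr _+_ 0ℝ (List.map f xs)) t ≡ ∑ xs (λ x → seq (f x) t)
  seq-foldr []       f t = refl
  seq-foldr (x ∷ xs) f t = cong (seq (f x) t ℚ.+_) (seq-foldr xs f t)

  seq-monomial : ∀ {n} (I : Subset n) x t → seq (monomial I x) t ≡ ℚ[x].monomial I (λ i → seq (x i) t)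
  seq-monomial I x t = trans (seq-product (λ i → if lookup I i then x i else 1ℝ) t) (ℚ[x].product-cong step)
    where
    step : ∀ i → seq (if lookup I i then x i else 1ℝ) t ≡ (if lookup I i then seq (x i) t else 1ℚ)
    step i with lookup I i
    ... | true  = refl
    ... | false = refl

  eventually-bounded : ∀ x → ∃[ b ] ∃[ N ] (∀ t → N ℕ.≤ t → ℚ.∣ seq x t ∣ ℚ.≤ ι b)
  eventually-bounded x with cauchy x 1ℚ (ℚ.positive⁻¹ 1ℚ)
  ... | N , close with archimedean (1ℚ ℚ.+ ℚ.∣ seq x N ∣)
  ... | b , bound = b , N , λ t N≤t → begin
    ℚ.∣ seq x t ∣                             ≡⟨ cong ℚ.∣_∣ (split (seq x t) (seq x N)) ⟩
    ℚ.∣ (seq x t ℚ.- seq x N) ℚ.+ seq x N ∣   ≤⟨ ℚ.∣p+q∣≤∣p∣+∣q∣ (seq x t ℚ.- seq x N) (seq x N) ⟩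
    ℚ.∣ seq x t ℚ.- seq x N ∣ ℚ.+ ℚ.∣ seq x N ∣ ≤⟨ ℚ.+-monoˡ-≤ ℚ.∣ seq x N ∣ (close t N N≤t ℕ.≤-refl) ⟩
    1ℚ ℚ.+ ℚ.∣ seq x N ∣                      ≤⟨ bound ⟩
    ι b                                       ∎
    where
    open ℚ.≤-Reasoning
    split : ∀ s t → s ≡ (s ℚ.- t) ℚ.+ t
    split = solve 2 (λ s t → s := (s :- t) :+ t) refl
      where open +-*-Solver

  +-cong-≈ : ∀ {x x′ y y′} → x ≈ x′ → y ≈ y′ → x + y ≈ x′ + y′
  +-cong-≈ {x} {x′} {y} {y′} x≈x′ y≈y′ ε 0<ε with x≈x′ (½ ℚ.* ε) 0<½ε | y≈y′ (½ ℚ.* ε) 0<½ε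
    where
    0<½ε : 0ℚ ℚ.< ½ ℚ.* ε
    0<½ε = subst (ℚ._< ½ ℚ.* ε) (ℚ.*-zeroʳ ½) (ℚ.*-monoʳ-<-pos ½ 0<ε)
  ... | M , p | N , q = M ℕ.⊔ N , λ t M⊔N≤t → begin
    ℚ.∣ (seq x t ℚ.+ seq y t) ℚ.- (seq x′ t ℚ.+ seq y′ t) ∣
      ≡⟨ cong ℚ.∣_∣ (rearrange (seq x t) (seq y t) (seq x′ t) (seq y′ t)) ⟩
    ℚ.∣ (seq x t ℚ.- seq x′ t) ℚ.+ (seq y t ℚ.- seq y′ t) ∣
      ≤⟨ ℚ.∣p+q∣≤∣p∣+∣q∣ (seq x t ℚ.- seq x′ t) (seq y t ℚ.- seq y′ t) ⟩
    ℚ.∣ seq x t ℚ.- seq x′ t ∣ ℚ.+ ℚ.∣ seq y t ℚ.- seq y′ t ∣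
      ≤⟨ ℚ.+-mono-≤ (p t (ℕ.m⊔n≤o⇒m≤o M N M⊔N≤t)) (q t (ℕ.m⊔n≤o⇒n≤o M N M⊔N≤t)) ⟩
    ½ ℚ.* ε ℚ.+ ½ ℚ.* ε
      ≡⟨ solve 1 (λ e → con ½ :* e :+ con ½ :* e := e) refl ε ⟩
    ε ∎
    where
    open ℚ.≤-Reasoning
    open +-*-Solver
    rearrange : ∀ s t u v → (s ℚ.+ t) ℚ.- (u ℚ.+ v) ≡ (s ℚ.- u) ℚ.+ (t ℚ.- v)
    rearrange = solve 4 (λ s t u v → (s :+ t) :- (u :+ v) := (s :- u) :+ (t :- v)) refl

  -- Linear forms must respect `≈`, where entries may differ, so estimates are required: `a` is
  -- eventually bounded by `b`, and closeness `ε/(b + 1)` suffices. Dividing by `b + 1` also covers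
  -- `b = 0`.
  *-congˡ-≈ : ∀ a {x y} → x ≈ y → a * x ≈ a * y
  *-congˡ-≈ a {x} {y} x≈y ε 0<ε =
    let b , M , bound = eventually-bounded a
        N , close = x≈y (recip b ℚ.* ε) (0<δ b)
    in M ℕ.⊔ N , λ t M⊔N≤t → step b t (bound t (ℕ.m⊔n≤o⇒m≤o M N M⊔N≤t)) (close t (ℕ.m⊔n≤o⇒n≤o M N M⊔N≤t))
    where
    open ℚ.≤-Reasoning
    open +-*-Solver
    0<δ : ∀ b → 0ℚ ℚ.< recip b ℚ.* ε
    0<δ b = subst (ℚ._< recip b ℚ.* ε) (ℚ.*-zeroʳ (recip b))
      (ℚ.*-monoʳ-<-pos (recip b) {{ℚ.normalize-pos 1 (suc b)}} 0<ε)
    factor : ∀ a x y → a ℚ.* x ℚ.- a ℚ.* y ≡ a ℚ.* (x ℚ.- y)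
    factor = solve 3 (λ a x y → a :* x :- a :* y := a :* (x :- y)) refl
    step : ∀ b t → ℚ.∣ seq a t ∣ ℚ.≤ ι b → ℚ.∣ seq x t ℚ.- seq y t ∣ ℚ.≤ recip b ℚ.* ε →
      ℚ.∣ seq a t ℚ.* seq x t ℚ.- seq a t ℚ.* seq y t ∣ ℚ.≤ ε
    step b t a≤b close = begin
      ℚ.∣ seq a t ℚ.* seq x t ℚ.- seq a t ℚ.* seq y t ∣
        ≡⟨ cong ℚ.∣_∣ (factor (seq a t) (seq x t) (seq y t)) ⟩
      ℚ.∣ seq a t ℚ.* (seq x t ℚ.- seq y t) ∣
        ≡⟨ ℚ.∣p*q∣≡∣p∣*∣q∣ (seq a t) (seq x t ℚ.- seq y t) ⟩
      ℚ.∣ seq a t ∣ ℚ.* ℚ.∣ seq x t ℚ.- seq y t ∣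
        ≤⟨ *-mono-≤-nonNeg (ℚ.∣-∣-nonNeg (seq x t ℚ.- seq y t)) (ι-nonNeg (suc b))
             (ℚ.≤-trans a≤b (ι-mono (ℕ.n≤1+n b))) close ⟩
      ι (suc b) ℚ.* (recip b ℚ.* ε)   ≡⟨ ℚ.*-assoc (ι (suc b)) (recip b) ε ⟨
      ι (suc b) ℚ.* recip b ℚ.* ε     ≡⟨ cong (ℚ._* ε) (ι*recip b) ⟩
      1ℚ ℚ.* ε                        ≡⟨ ℚ.*-identityˡ ε ⟩
      ε                               ∎

  sum-cong-≈ : ∀ {n} (x y : Fin n → ℝ) → (∀ i → x i ≈ y i) → sum x ≈ sum y
  sum-cong-≈ {zero}  x y x≈y = termwise 0ℝ 0ℝ (λ t → refl)
  sum-cong-≈ {suc n} x y x≈y = +-cong-≈ {x zero} {y zero} {sum (x ∘ suc)} {sum (y ∘ suc)}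
    (x≈y zero) (sum-cong-≈ (x ∘ suc) (y ∘ suc) (x≈y ∘ suc))

  module _ {n} (a : Fin n → ℝ) where
    -- Opaque, so that values of linear forms are not compared through their moduli of convergence.
    opaque
      form : (Fin n → ℝ) → ℝ
      form x = sum (λ i → a i * x i)

      seq-form : ∀ x t → seq (form x) t ≡ combination (λ i → seq (a i) t) (λ i → seq (x i) t)
      seq-form x = seq-sum (λ i → a i * x i)

      form-cong : ∀ {x y} → (∀ i → x i ≈ y i) → form x ≈ form y
      form-cong {x} {y} x≈y = sum-cong-≈ (λ i → a i * x i) (λ i → a i * y i)
        (λ i → *-congˡ-≈ (a i) {x i} {y i} (x≈y i))

    form-+ : ∀ x y → form (λ i → x i + y i) ≈ form x + form y
    form-+ x y = termwise (form (λ i → x i + y i)) (form x + form y) λ t → trans (seq-form (λ i → x i + y i) t)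
      (trans (combination-+ (λ i → seq (a i) t) (λ i → seq (x i) t) (λ i → seq (y i) t))
        (sym (cong₂ ℚ._+_ (seq-form x t) (seq-form y t))))

    form-0 : form (λ _ → 0ℝ) ≈ 0ℝ
    form-0 = termwise (form (λ _ → 0ℝ)) 0ℝ λ t → trans (seq-form (λ _ → 0ℝ) t) (combination-0 (λ i → seq (a i) t))

    form-neg : ∀ x → form (λ i → - x i) ≈ - form x
    form-neg x = termwise (form (λ i → - x i)) (- form x) λ t → trans (seq-form (λ i → - x i) t)
      (trans (combination-neg (λ i → seq (a i) t) (λ i → seq (x i) t)) (sym (cong ℚ.-_ (seq-form x t))))

    form-* : ∀ y x → form (λ i → y * x i) ≈ y * form x
    form-* y x = termwise (form (λ i → y * x i)) (y * form x) λ t → trans (seq-form (λ i → y * x i) t)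
      (trans (combination-* (λ i → seq (a i) t) (seq y t) (λ i → seq (x i) t))
        (sym (cong (seq y t ℚ.*_) (seq-form x t))))

    linearForm : LinearForm n
    linearForm = record
      { ⟦_⟧ = form
      ; isLinear = record
        { +ᴹ-isGroupHomomorphism = record
          { isMonoidHomomorphism = record
            { isMagmaHomomorphism = record
              { isRelHomomorphism = record { cong = λ {x} {y} → form-cong {x} {y} }
              ; homo = form-+
              }
            ; ε-homo = form-0
            }
          ; ⁻¹-homo = form-neg
          }
        ; *ₗ-homo = form-*
        }
      }

  eventually-≤ : ∀ x y N → (∀ t → N ℕ.≤ t → seq x t ℚ.≤ seq y t) → x ≤ y
  eventually-≤ x y N le ε 0<ε = N , λ t N≤t → ℚ.≤-trans (le t N≤t)
    (subst (ℚ._≤ seq y t ℚ.+ ε) (ℚ.+-identityʳ (seq y t)) (ℚ.+-monoʳ-≤ (seq y t) (ℚ.<⇒≤ 0<ε)))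

  sum-indicator : ∀ {k} (R : Fin k → Bool) → sumℚ (λ i → ℚ[x].indicator (R i)) ≡ ι (count R)
  sum-indicator {zero}  R = refl
  sum-indicator {suc k} R with R zero
  ... | true  = trans (cong (1ℚ ℚ.+_) (sum-indicator (R ∘ suc))) (sym (ι-suc (count (R ∘ suc))))
  ... | false = trans (ℚ.+-identityˡ _) (sum-indicator (R ∘ suc))

  indicator : Bool → ℝ
  indicator b = if b then 1ℝ else 0ℝ

  seq-indicator : ∀ b t → seq (indicator b) t ≡ ℚ[x].indicator b
  seq-indicator true  t = refl
  seq-indicator false t = refl

  coefficient : ∀ {r n} → ℝ → Vec (Fin r) n → Fin r → Fin n → ℝ
  coefficient s χ zero    i = s * indicator (ℚ[x].same (lookup χ i) zero)
  coefficient s χ (suc j) i = indicator (ℚ[x].same (lookup χ i) (suc j))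

  seq-coefficient : ∀ {r n} s (χ : Vec (Fin r) n) j i t →
    seq (coefficient s χ j i) t ≡ ℚ[x].scaled-colour-sum (seq s t) χ j i
  seq-coefficient s χ zero    i t = cong (seq s t ℚ.*_) (seq-indicator (ℚ[x].same (lookup χ i) zero) t)
  seq-coefficient s χ (suc j) i t = seq-indicator (ℚ[x].same (lookup χ i) (suc j)) t

  module _ {r n k} (s : ℝ) (χ : Fin k → Vec (Fin (suc r)) n) where
    rainbow-coefficient : Subset n → ℝ
    rainbow-coefficient I = s * fromℕ (count (λ i → rainbow ⊤ I (χ i)))

    sum-of-products-squareFree : ∀ x →
      sum (λ i → product (λ j → ⟦ linearForm (coefficient s (χ i) j) ⟧ x)) ≈ squareFree (suc r) rainbow-coefficient x
    sum-of-products-squareFree x = termwise (sum (λ i → product (λ j → ⟦ linearForm (coefficient s (χ i) j) ⟧ x)))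
      (squareFree (suc r) rainbow-coefficient x) λ t → begin
      seq (sum (λ i → product (λ j → ⟦ linearForm (coefficient s (χ i) j) ⟧ x))) t
        ≡⟨ seq-sum (λ i → product (λ j → ⟦ linearForm (coefficient s (χ i) j) ⟧ x)) t ⟩
      sumℚ (λ i → seq (product (λ j → ⟦ linearForm (coefficient s (χ i) j) ⟧ x)) t)
        ≡⟨ sumℚ-cong (λ i → trans (seq-product (λ j → ⟦ linearForm (coefficient s (χ i) j) ⟧ x) t)
             (ℚ[x].product-cong (λ j → trans (seq-form (coefficient s (χ i) j) x t)
               (sumℚ-cong (λ l → cong (ℚ._* seq (x l) t) (seq-coefficient s (χ i) j l t)))))) ⟩
      sumℚ (λ i → productℚ (λ j → sumℚ (λ l → ℚ[x].scaled-colour-sum (seq s t) (χ i) j l ℚ.* seq (x l) t)))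
        ≡⟨ ℚ[x].sum-of-products (seq s t) χ (λ i → seq (x i) t) ⟩
      ∑ (subsetsOfSize n (suc r)) (λ I → seq s t ℚ.* sumℚ (λ i → ℚ[x].indicator (rainbow ⊤ I (χ i))) ℚ.*
        ℚ[x].monomial I (λ i → seq (x i) t))
        ≡⟨ ∑-cong (subsetsOfSize n (suc r)) (λ I → cong₂ ℚ._*_
             (cong (seq s t ℚ.*_) (sum-indicator (λ i → rainbow ⊤ I (χ i)))) (sym (seq-monomial I x t))) ⟩
      ∑ (subsetsOfSize n (suc r)) (λ I → seq (rainbow-coefficient I * monomial I x) t)
        ≡⟨ seq-foldr (subsetsOfSize n (suc r)) (λ I → rainbow-coefficient I * monomial I x) t ⟨
      seq (squareFree (suc r) rainbow-coefficient x) t ∎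
      where open ≡-Reasoning

  -- Bounds for the coefficients.

  ^-nonNeg : ∀ y t → ℚ.NonNegative (seq y t) → ∀ n → ℚ.NonNegative (seq (y ^ n) t)
  ^-nonNeg y t y≥0 zero    = _
  ^-nonNeg y t y≥0 (suc n) = ℚ.nonNeg*nonNeg⇒nonNeg (seq y t) {{y≥0}} (seq (y ^ n) t) {{^-nonNeg y t y≥0 n}}

  module _ (x y : ℝ) (t : ℕ) where
    ∣^∣-mono : ℚ.NonNegative (seq y t) → ℚ.∣ seq x t ∣ ℚ.≤ seq y t →
      ∀ n → ℚ.∣ seq (x ^ n) t ∣ ℚ.≤ seq (y ^ n) t
    ∣^∣-mono y≥0 ∣x∣≤y zero    = ℚ.≤-refl
    ∣^∣-mono y≥0 ∣x∣≤y (suc n) = subst (ℚ._≤ seq (y ^ suc n) t)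
      (sym (ℚ.∣p*q∣≡∣p∣*∣q∣ (seq x t) (seq (x ^ n) t)))
      (*-mono-≤-nonNeg (ℚ.∣-∣-nonNeg (seq (x ^ n) t)) y≥0 ∣x∣≤y (∣^∣-mono y≥0 ∣x∣≤y n))

    -- One of the `n + 1` factors supplies `u`, and the others only use `∣ x ∣ ≤ y`. Absolute values
    -- are needed because `x`, which will be `1 − ε`, may be negative.
    ^-contraction : ∀ u → ℚ.NonNegative u → u ℚ.≤ 1ℚ → ℚ.NonNegative (seq y t) →
      ℚ.∣ seq x t ∣ ℚ.≤ u ℚ.* seq y t → ∀ n → seq (x ^ suc n) t ℚ.≤ u ℚ.* seq (y ^ suc n) t
    ^-contraction u u≥0 u≤1 y≥0 ∣x∣≤uy n = begin
      seq x t ℚ.* seq (x ^ n) t                ≤⟨ ≤∣∣ _ ⟩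
      ℚ.∣ seq x t ℚ.* seq (x ^ n) t ∣          ≡⟨ ℚ.∣p*q∣≡∣p∣*∣q∣ (seq x t) (seq (x ^ n) t) ⟩
      ℚ.∣ seq x t ∣ ℚ.* ℚ.∣ seq (x ^ n) t ∣    ≤⟨ *-mono-≤-nonNeg (ℚ.∣-∣-nonNeg (seq (x ^ n) t))
                                                    (ℚ.nonNeg*nonNeg⇒nonNeg u {{u≥0}} (seq y t) {{y≥0}})
                                                    ∣x∣≤uy (∣^∣-mono y≥0 ∣x∣≤y n) ⟩
      u ℚ.* seq y t ℚ.* seq (y ^ n) t          ≡⟨ ℚ.*-assoc u (seq y t) (seq (y ^ n) t) ⟩
      u ℚ.* (seq y t ℚ.* seq (y ^ n) t)        ∎
      where
      open ℚ.≤-Reasoning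
      ∣x∣≤y : ℚ.∣ seq x t ∣ ℚ.≤ seq y t
      ∣x∣≤y = ℚ.≤-trans ∣x∣≤uy (subst (u ℚ.* seq y t ℚ.≤_) (ℚ.*-identityˡ (seq y t))
        (ℚ.*-monoʳ-≤-nonNeg (seq y t) {{y≥0}} u≤1))

  -- The gap `δ` in `0 < ε` and an eventual bound `b` on `ε` enclose the entries of `ε`; any `h`
  -- above both `b` and `1/δ` then satisfies `contraction`, with no comparison of `ε` and 1.
  contraction-factor : ∀ ε → 0ℝ < ε → ∃[ h ] ∃[ N ] (∀ t → N ℕ.≤ t →
    0ℚ ℚ.≤ seq ε t × ι (suc h) ℚ.* ℚ.∣ 1ℚ ℚ.- seq ε t ∣ ℚ.≤ ι h ℚ.* (1ℚ ℚ.+ seq ε t))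
  contraction-factor ε (δ , 0<δ , M , δ≤ε) =
    let b , N , ∣ε∣≤b = eventually-bounded ε
        d , 1≤dδ = archimedean-recip δ 0<δ
    in b ℕ.⊔ d , M ℕ.⊔ N , λ t M⊔N≤t →
      let δ≤εt = subst (ℚ._≤ seq ε t) (ℚ.+-identityˡ δ) (δ≤ε t (ℕ.m⊔n≤o⇒m≤o M N M⊔N≤t))
      in ℚ.≤-trans (ℚ.<⇒≤ 0<δ) δ≤εt ,
        contraction (b ℕ.⊔ d) δ (seq ε t)
          (ℚ.≤-trans 1≤dδ (ℚ.*-monoʳ-≤-nonNeg δ {{ℚ.nonNegative (ℚ.<⇒≤ 0<δ)}} (ι-mono (ℕ.m≤n⊔m b d))))
          δ≤εt
          (ℚ.≤-trans (≤∣∣ (seq ε t)) (ℚ.≤-trans (∣ε∣≤b t (ℕ.m⊔n≤o⇒n≤o M N M⊔N≤t)) (ι-mono (ℕ.m≤m⊔n b d))))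

  scale : ℝ → ℕ → ℕ → ℝ
  scale ε r C = (1ℝ + ε) ^ suc r * fromℚ (recip C)

  module _ (ε : ℝ) (h N : ℕ)
      (factor : ∀ t → N ℕ.≤ t →
        0ℚ ℚ.≤ seq ε t × ι (suc h) ℚ.* ℚ.∣ 1ℚ ℚ.- seq ε t ∣ ℚ.≤ ι h ℚ.* (1ℚ ℚ.+ seq ε t))
      (r C c : ℕ) (c≤C : c ℕ.≤ suc C) (hC≤c : h ℕ.* suc C ℕ.≤ suc h ℕ.* c) where
    open ℚ.≤-Reasoning
    open +-*-Solver

    private
      -- The normalised count, which lies between `h/(h + 1)` and 1.
      u : ℚ
      u = ι c ℚ.* recip C

      u≥0 : ℚ.NonNegative u
      u≥0 = ℚ.nonNeg*nonNeg⇒nonNeg (ι c) {{ι-nonNeg c}} (recip C) {{recip-nonNeg C}}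

      ι*u : ι (suc C) ℚ.* u ≡ ι c
      ι*u = trans (solve 3 (λ x y z → x :* (y :* z) := y :* (x :* z)) refl (ι (suc C)) (ι c) (recip C))
        (trans (cong (ι c ℚ.*_) (ι*recip C)) (ℚ.*-identityʳ (ι c)))

      u≤1 : u ℚ.≤ 1ℚ
      u≤1 = ℚ.*-cancelˡ-≤-pos (ι (suc C)) {{ι-pos C}} (begin
        ι (suc C) ℚ.* u     ≡⟨ ι*u ⟩
        ι c                 ≤⟨ ι-mono c≤C ⟩
        ι (suc C)           ≡⟨ ℚ.*-identityʳ (ι (suc C)) ⟨
        ι (suc C) ℚ.* 1ℚ    ∎)

      h≤u : ι h ℚ.≤ ι (suc h) ℚ.* u
      h≤u = ℚ.*-cancelˡ-≤-pos (ι (suc C)) {{ι-pos C}} (begin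
        ι (suc C) ℚ.* ι h                  ≡⟨ ℚ.*-comm (ι (suc C)) (ι h) ⟩
        ι h ℚ.* ι (suc C)                  ≡⟨ ι-* h (suc C) ⟨
        ι (h ℕ.* suc C)                    ≤⟨ ι-mono hC≤c ⟩
        ι (suc h ℕ.* c)                    ≡⟨ ι-* (suc h) c ⟩
        ι (suc h) ℚ.* ι c                  ≡⟨ cong (ι (suc h) ℚ.*_) ι*u ⟨
        ι (suc h) ℚ.* (ι (suc C) ℚ.* u)    ≡⟨ solve 3 (λ x y z → x :* (y :* z) := y :* (x :* z)) refl (ι (suc h)) (ι (suc C)) u ⟩
        ι (suc C) ℚ.* (ι (suc h) ℚ.* u)    ∎)

      seq-scaled : ∀ t → seq (scale ε r C * fromℕ c) t ≡ u ℚ.* seq ((1ℝ + ε) ^ suc r) t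
      seq-scaled t = solve 3 (λ y q c → y :* q :* c := c :* q :* y) refl (seq ((1ℝ + ε) ^ suc r) t) (recip C) (ι c)

      1+ε≥0 : ∀ t → N ℕ.≤ t → ℚ.NonNegative (seq (1ℝ + ε) t)
      1+ε≥0 t N≤t = ℚ.nonNeg+nonNeg⇒nonNeg 1ℚ (seq ε t) {{ℚ.nonNegative (proj₁ (factor t N≤t))}}

      ∣1-ε∣≤ : ∀ t → N ℕ.≤ t → ℚ.∣ seq (1ℝ - ε) t ∣ ℚ.≤ u ℚ.* seq (1ℝ + ε) t
      ∣1-ε∣≤ t N≤t = ℚ.*-cancelˡ-≤-pos (ι (suc h)) {{ι-pos h}} (begin
        ι (suc h) ℚ.* ℚ.∣ seq (1ℝ - ε) t ∣      ≤⟨ proj₂ (factor t N≤t) ⟩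
        ι h ℚ.* seq (1ℝ + ε) t                  ≤⟨ ℚ.*-monoʳ-≤-nonNeg (seq (1ℝ + ε) t) {{1+ε≥0 t N≤t}} h≤u ⟩
        ι (suc h) ℚ.* u ℚ.* seq (1ℝ + ε) t      ≡⟨ ℚ.*-assoc (ι (suc h)) u (seq (1ℝ + ε) t) ⟩
        ι (suc h) ℚ.* (u ℚ.* seq (1ℝ + ε) t)    ∎)

    scaled-lower : (1ℝ - ε) ^ suc r ≤ scale ε r C * fromℕ c
    scaled-lower = eventually-≤ ((1ℝ - ε) ^ suc r) (scale ε r C * fromℕ c) N λ t N≤t →
      subst (seq ((1ℝ - ε) ^ suc r) t ℚ.≤_) (sym (seq-scaled t))
        (^-contraction (1ℝ - ε) (1ℝ + ε) t u u≥0 u≤1 (1+ε≥0 t N≤t) (∣1-ε∣≤ t N≤t) r)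

    scaled-upper : scale ε r C * fromℕ c ≤ (1ℝ + ε) ^ suc r
    scaled-upper = eventually-≤ (scale ε r C * fromℕ c) ((1ℝ + ε) ^ suc r) N λ t N≤t → begin
      seq (scale ε r C * fromℕ c) t             ≡⟨ seq-scaled t ⟩
      u ℚ.* seq ((1ℝ + ε) ^ suc r) t
        ≤⟨ ℚ.*-monoʳ-≤-nonNeg (seq ((1ℝ + ε) ^ suc r) t) {{^-nonNeg (1ℝ + ε) t (1+ε≥0 t N≤t) (suc r)}} u≤1 ⟩
      1ℚ ℚ.* seq ((1ℝ + ε) ^ suc r) t     ≡⟨ ℚ.*-identityˡ (seq ((1ℝ + ε) ^ suc r) t) ⟩
      seq ((1ℝ + ε) ^ suc r) t            ∎

-- Choice of the number of colourings.

module Parameters where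
  open Rationals
  open Reals
  open Rainbow using (length-subsetsOfSize)
  open Logarithm

  -- From `n ≥ 2` the lower exponent is at least 1, so additive constants can be absorbed into
  -- multiples of it.
  dyadic⁺ : ∀ n → 2 ℕ.≤ n → ∃[ l ] (2 ℕ.^ suc l ℕ.≤ n × suc n ℕ.≤ 2 ℕ.^ suc (suc l))
  dyadic⁺ n 2≤n with dyadic n (ℕ.<⇒≤ 2≤n)
  ... | zero  , _     , n<2     = ⊥-elim (ℕ.<⇒≱ n<2 2≤n)
  ... | suc l , 2^l≤n , n<2^1+l = l , 2^l≤n , n<2^1+l

  -- Of the 2 in the exponent, one unit pays for counting each event with its complement and one for
  -- strictness.
  few : ∀ n r l → suc n ℕ.≤ 2 ℕ.^ l → 2 ℕ.* length (subsetsOfSize n r) ℕ.< 2 ℕ.^ (2 ℕ.+ r ℕ.* l)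
  few n r l n<2^l = begin-strict
    2 ℕ.* length (subsetsOfSize n r)  ≤⟨ ℕ.*-monoʳ-≤ 2 (length-subsetsOfSize n r) ⟩
    2 ℕ.* suc n ℕ.^ r                      ≤⟨ ℕ.*-monoʳ-≤ 2 (ℕ.^-monoˡ-≤ r n<2^l) ⟩
    2 ℕ.* (2 ℕ.^ l) ℕ.^ r                  ≡⟨ cong (2 ℕ.*_) (trans (ℕ.^-*-assoc 2 l r) (cong (2 ℕ.^_) (ℕ.*-comm l r))) ⟩
    2 ℕ.^ (1 ℕ.+ r ℕ.* l)                  <⟨ ℕ.^-monoʳ-< 2 (ℕ.s≤s (ℕ.s≤s ℕ.z≤n)) (ℕ.n<1+n (1 ℕ.+ r ℕ.* l)) ⟩
    2 ℕ.^ (2 ℕ.+ r ℕ.* l)                  ∎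
    where open ℕ.≤-Reasoning

  -- The left side comes from `suc n` being at most 2 to the power `l + 2`, the right side is a
  -- multiple of the exponent `l + 1` available below `n`; the slack is `p(2 + r)l`.
  rounds≤ : ∀ p r l → p ℕ.* (2 ℕ.+ r ℕ.* suc (suc l)) ℕ.≤ p ℕ.* (2 ℕ.+ 2 ℕ.* r) ℕ.* suc l
  rounds≤ p r l = begin
    p ℕ.* (2 ℕ.+ r ℕ.* suc (suc l))                            ≤⟨ ℕ.*-monoʳ-≤ p (ℕ.m≤m+n _ ((2 ℕ.+ r) ℕ.* l)) ⟩
    p ℕ.* (2 ℕ.+ r ℕ.* suc (suc l) ℕ.+ (2 ℕ.+ r) ℕ.* l)        ≡⟨ lemma p r l ⟩
    p ℕ.* (2 ℕ.+ 2 ℕ.* r) ℕ.* suc l                            ∎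
    where
    open ℕ.≤-Reasoning
    lemma : ∀ p r l → p ℕ.* (2 ℕ.+ r ℕ.* suc (suc l) ℕ.+ (2 ℕ.+ r) ℕ.* l) ≡ p ℕ.* (2 ℕ.+ 2 ℕ.* r) ℕ.* suc l
    lemma = solve-∀

  -- The factor 2 in the constant undoes the ½ of `riemann-lower`.
  logarithmic : ∀ k K l n → k ℕ.≤ K ℕ.* l → 2 ℕ.^ l ℕ.≤ n → fromℕ k ≤ fromℕ (2 ℕ.* K) * ln n
  logarithmic k K l n k≤Kl 2^l≤n = eventually-≤ (fromℕ k) (fromℕ (2 ℕ.* K) * ln n) 0 λ t _ → begin
    ι k                                     ≤⟨ ι-mono k≤Kl ⟩
    ι (K ℕ.* l)                             ≡⟨ ι-* K l ⟩
    ι K ℚ.* ι l                             ≡⟨ solve 2 (λ x y → x :* y := (con (ι 2) :* x) :* (y :* con ½)) refl (ι K) (ι l) ⟩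
    (ι 2 ℚ.* ι K) ℚ.* (ι l ℚ.* ½)           ≡⟨ cong (ℚ._* (ι l ℚ.* ½)) (ι-* 2 K) ⟨
    ι (2 ℕ.* K) ℚ.* (ι l ℚ.* ½)             ≤⟨ ℚ.*-monoˡ-≤-nonNeg (ι (2 ℕ.* K)) {{ι-nonNeg (2 ℕ.* K)}} (riemann-lower n l t 2^l≤n) ⟩
    ι (2 ℕ.* K) ℚ.* riemann (n ℕ.∸ 1) t     ∎
    where
    open ℚ.≤-Reasoning
    open +-*-Solver

  fromℕ-positive : ∀ k → 1 ℕ.≤ k → 0ℝ < fromℕ k
  fromℕ-positive k 1≤k = 1ℚ , ℚ.positive⁻¹ 1ℚ , 0 , λ _ _ →
    subst (ℚ._≤ ι k) (sym (ℚ.+-identityˡ 1ℚ)) (ι-mono 1≤k)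

open Reals
open Balanced
open Parameters

theorem1p4 : (r : ℕ) → 1 ℕ.≤ r → (ε : ℝ) → 0ℝ < ε →
    Σ[ κ ∈ ℝ ] (0ℝ < κ ×
    ((n : ℕ) → 2 ℕ.≤ n →
    Σ[ k ∈ ℕ ] (fromℕ k ≤ κ * ln n ×
    (Σ[ ℓ ∈ (Fin k → Fin r → LinearForm n) ]
    (Σ[ e ∈ (Subset n → ℝ) ]
    ((∀ (x : Fin n → ℝ) →
    sum (λ i → product (λ j → ⟦ ℓ i j ⟧ x)) ≈ squareFree r e x)
    × (∀ (I : Subset n) → ∣ I ∣ ≡ r →
    (1ℝ - ε) ^ r ≤ e I × e I ≤ (1ℝ + ε) ^ r)))))))
theorem1p4 (suc r) _ ε 0<ε =
  let h , N , factor = contraction-factor ε 0<ε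
      -- `p` and `K` are fixed before `n` and depend only on `r` and on `h`, which was obtained from
      -- `ε`.
      p = per-round (suc r) h
      K = p ℕ.* (2 ℕ.+ 2 ℕ.* suc r)
      1≤2K = ℕ.*-mono-≤ {1} {2} {1} {K} (ℕ.s≤s ℕ.z≤n)
        (ℕ.*-mono-≤ (ℕ.>-nonZero⁻¹ p {{per-round≢0 (suc r) h}}) (ℕ.s≤s ℕ.z≤n))
  in fromℕ (2 ℕ.* K) , fromℕ-positive (2 ℕ.* K) 1≤2K , λ n 2≤n →
  let l , 2^l≤n , n<2^1+l = dyadic⁺ n 2≤n
      C , k , k≡ , χ , tails = balanced (suc r) h n (2 ℕ.+ suc r ℕ.* suc (suc l)) (few n (suc r) (suc (suc l)) n<2^1+l)
      s = scale ε r C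
  in k ,
     logarithmic k K (suc l) n (subst (ℕ._≤ K ℕ.* suc l) (sym k≡) (rounds≤ p (suc r) l)) 2^l≤n ,
     (λ i j → linearForm (coefficient s (χ i) j)) ,
     rainbow-coefficient s χ ,
     sum-of-products-squareFree s χ ,
     λ I ∣I∣≡r →
       let c≤C , hC≤c = tails I ∣I∣≡r
       in scaled-lower ε h N factor r C _ c≤C hC≤c , scaled-upper ε h N factor r C _ c≤C hC≤c
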